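{- Let $d$ be a nonnegative integer and let $A\in \mathrm{Mat}_{d+1}(\mathbb{R})$ be a nonnegative matrix (every entry is nonnegative). Then for all $0\le s,t\le d$ the following are equivalent. (i) The matrix $A$ is diagonalizable (over $\mathbb{R}$), and $\partial(s,t)=d$ in the directed graph $\Gamma(A)$. (ii) The matrix $A$ is multiplicity-free. Moreover, with $\{\theta_i\}_{i=0}^d$ an ordering of the eigenvalues of $A$ and $E_i$ the primitive idempotent of $A$ associated with $\theta_i$, the $(s,t)$-entry of $E_i$ times $$(\theta_i-\theta_0)\cdots(\theta_i-\theta_{i-1})(\theta_i-\theta_{i+1})\cdots(\theta_i-\theta_d)$$ is independent of $i$ for $0\le i\le d$, and this common value is nonzero.
   Context: $\mathrm{Mat}_{d+1}(\mathbb{R})$ is the algebra of $(d+1)\times(d+1)$ real matrices, with rows and columns indexed by $0,1,\ldots,d$; it acts on $V=\mathbb{R}^{d+1}$ by left multiplication. $\Gamma(A)$ is the directed graph with vertex set $\{0,1,\ldots,d\}$, where $i\rightarrow j$ whenever $i\ne j$ and $A_{ij}\neq 0$. The directed distance $\partial$ is defined by: $\partial(s,t)=i$ whenever there exists a directed path from $s$ to $t$ of length $i$ and there is no directed path from $s$ to $t$ of length less than $i$. $A$ is multiplicity-free whenever $A$ is diagonalizable over $\mathbb{R}$ and all its eigenspaces have dimension $1$. In this case let $\{\theta_i\}_{i=0}^d$ be an ordering of the eigenvalues of $A$ and let $V_i$ be the eigenspace for $\theta_i$; the primitive idempotent $E_i\in\mathrm{Mat}_{d+1}(\mathbb{R})$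 of $A$ associated with $\theta_i$ is defined by $(E_i-I)V_i=0$ and $E_iV_j=0$ for $j\neq i$. Empty products equal $1$. -}

module Defs where

open import Level using (0ℓ)
open import Algebra.Bundles.Raw using (RawRing)
import Algebra.Definitions.RawMonoid as RawMonoidDefs
open import Data.Bool.Base using (if_then_else_)
open import Data.Fin.Base using (Fin)
open import Data.Fin.Properties using () renaming (_≟_ to _≟ᶠ_)
open import Data.Nat.Base as ℕ using (ℕ; zero; suc)
import Data.Nat.Properties as ℕₚ
open import Data.Product.Base using (Σ-syntax; ∃-syntax; _×_; _,_)
open import Data.Rational.Base as ℚ using (ℚ; 0ℚ; 1ℚ; ½; ∣_∣)
import Data.Rational.Properties as ℚₚ
open import Data.Rational.Solver using (module +-*-Solver)
open import Data.Sum.Base using (_⊎_)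
open import Data.Vec.Functional using (Vector; removeAt)
open import Function.Definitions using (Injective)
open import Relation.Binary.PropositionalEquality using (_≡_; _≢_; refl; sym; trans; cong; subst)
open import Relation.Nullary using (¬_; does)
open import Relation.Unary using (Pred; _∈_)

-- A real number is a Cauchy sequence of rationals; equality of reals is _≃_ below.
IsCauchy : (ℕ → ℚ) → Set
IsCauchy f = ∀ ε → 0ℚ ℚ.< ε →
  Σ[ N ∈ ℕ ] (∀ m n → N ℕ.≤ m → N ℕ.≤ n → ∣ f m ℚ.- f n ∣ ℚ.< ε)

record ℝ : Set where
  constructor mkℝ
  field
    seq    : ℕ → ℚ
    cauchy : IsCauchy seq

open ℝ public

infix 4 _≃_ _<_ _≤_ _#_

record _≃_ (x y : ℝ) : Set where
  constructor mk≃
  field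
    ≃-close : ∀ ε → 0ℚ ℚ.< ε →
      Σ[ N ∈ ℕ ] (∀ n → N ℕ.≤ n → ∣ seq x n ℚ.- seq y n ∣ ℚ.< ε)

open _≃_ public

record _≤_ (x y : ℝ) : Set where
  constructor mk≤
  field
    ≤-bound : ∀ ε → 0ℚ ℚ.< ε →
      Σ[ N ∈ ℕ ] (∀ n → N ℕ.≤ n → seq x n ℚ.≤ seq y n ℚ.+ ε)

open _≤_ public

record _<_ (x y : ℝ) : Set where
  constructor mk<
  field
    gap     : ℚ
    gap-pos : 0ℚ ℚ.< gap
    from    : ℕ
    <-bound : ∀ n → from ℕ.≤ n → seq x n ℚ.+ gap ℚ.≤ seq y n

open _<_ public

-- Apartness: the constructive form of x ≠ y, classically equivalent to ¬ (x ≃ y).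
_#_ : ℝ → ℝ → Set
x # y = x < y ⊎ y < x

-- The closure proofs are abstract because the value of a modulus is never
-- relevant, while normalising it is very expensive.
module CauchyLemmas where
  rearrange-+ : ∀ a b c d → (a ℚ.- b) ℚ.+ (c ℚ.- d) ≡ (a ℚ.+ c) ℚ.- (b ℚ.+ d)
  rearrange-+ = solve 4 (λ a b c d → (a :- b) :+ (c :- d) := (a :+ c) :- (b :+ d)) refl
    where open +-*-Solver

  rearrange-* : ∀ a b c d → (a ℚ.- b) ℚ.* d ℚ.+ (c ℚ.- d) ℚ.* a ≡ a ℚ.* c ℚ.- b ℚ.* d
  rearrange-* = solve 4 (λ a b c d → (a :- b) :* d :+ (c :- d) :* a := a :* c :- b :* d) refl
    where open +-*-Solver

  cancel : ∀ a b → (a ℚ.- b) ℚ.+ b ≡ a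
  cancel = solve 2 (λ a b → (a :- b) :+ b := a) refl
    where open +-*-Solver

  half-pos : ∀ {ε} → 0ℚ ℚ.< ε → 0ℚ ℚ.< ε ℚ.* ½
  half-pos {ε} 0<ε = subst (ℚ._< ε ℚ.* ½) (ℚₚ.*-zeroˡ ½) (ℚₚ.*-monoˡ-<-pos ½ 0<ε)

  half+half : ∀ ε → ε ℚ.* ½ ℚ.+ ε ℚ.* ½ ≡ ε
  half+half ε = trans (sym (ℚₚ.*-distribˡ-+ ε ½ ½)) (ℚₚ.*-identityʳ ε)

  ∣+∣<-halves : ∀ {ε} p q → ∣ p ∣ ℚ.< ε ℚ.* ½ → ∣ q ∣ ℚ.< ε ℚ.* ½ → ∣ p ℚ.+ q ∣ ℚ.< ε
  ∣+∣<-halves {ε} p q p< q< =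
    subst (∣ p ℚ.+ q ∣ ℚ.<_) (half+half ε)
      (ℚₚ.≤-<-trans (ℚₚ.∣p+q∣≤∣p∣+∣q∣ p q) (ℚₚ.+-mono-< p< q<))

  abstract
    const-cauchy : ∀ q → IsCauchy (λ _ → q)
    const-cauchy q ε 0<ε = 0 , λ _ _ _ _ → subst (λ r → ∣ r ∣ ℚ.< ε) (sym (ℚₚ.+-inverseʳ q)) 0<ε

  abstract
    +-cauchy : ∀ {f g} → IsCauchy f → IsCauchy g → IsCauchy (λ n → f n ℚ.+ g n)
    +-cauchy {f} {g} cf cg ε 0<ε =
      let N₁ , p = cf (ε ℚ.* ½) (half-pos 0<ε)
          N₂ , q = cg (ε ℚ.* ½) (half-pos 0<ε)
      in N₁ ℕ.⊔ N₂ , λ m n N≤m N≤n →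
      subst (λ r → ∣ r ∣ ℚ.< ε) (rearrange-+ (f m) (f n) (g m) (g n))
        (∣+∣<-halves (f m ℚ.- f n) (g m ℚ.- g n)
          (p m n (ℕₚ.m⊔n≤o⇒m≤o N₁ N₂ N≤m) (ℕₚ.m⊔n≤o⇒m≤o N₁ N₂ N≤n))
          (q m n (ℕₚ.m⊔n≤o⇒n≤o N₁ N₂ N≤m) (ℕₚ.m⊔n≤o⇒n≤o N₁ N₂ N≤n)))

  abstract
    neg-cauchy : ∀ {f} → IsCauchy f → IsCauchy (λ n → ℚ.- f n)
    neg-cauchy {f} cf ε 0<ε =
      let N , p = cf ε 0<ε
      in N , λ m n N≤m N≤n →
      subst (ℚ._< ε)
        (trans (sym (ℚₚ.∣-p∣≡∣p∣ (f m ℚ.- f n))) (cong ∣_∣ (ℚₚ.neg-distrib-+ (f m) (ℚ.- f n))))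
        (p m n N≤m N≤n)

  EventuallyBounded : (ℕ → ℚ) → ℚ → Set
  EventuallyBounded f B = Σ[ N ∈ ℕ ] (∀ n → N ℕ.≤ n → ∣ f n ∣ ℚ.≤ B)

  eventually-bounded : ∀ {f} → IsCauchy f →
    Σ[ B ∈ ℚ ] ℚ.Positive B × EventuallyBounded f B
  eventually-bounded {f} cf =
    let N , p = cf 1ℚ (ℚₚ.positive⁻¹ 1ℚ)
    in 1ℚ ℚ.+ ∣ f N ∣
     , ℚₚ.pos+nonNeg⇒pos 1ℚ ∣ f N ∣ {{ℚₚ.∣-∣-nonNeg (f N)}}
     , N
     , λ n N≤n → subst (λ r → ∣ r ∣ ℚ.≤ 1ℚ ℚ.+ ∣ f N ∣) (cancel (f n) (f N))
         (ℚₚ.≤-trans (ℚₚ.∣p+q∣≤∣p∣+∣q∣ (f n ℚ.- f N) (f N))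
           (ℚₚ.+-monoˡ-≤ ∣ f N ∣ (ℚₚ.<⇒≤ (p n N N≤n ℕₚ.≤-refl))))

  recip : ∀ B → ℚ.Positive B → ℚ
  recip B B>0 = (ℚ.1/ B) {{ℚₚ.pos⇒nonZero B {{B>0}}}}

  scale-pos : ∀ B B>0 {ε} → 0ℚ ℚ.< ε → 0ℚ ℚ.< ε ℚ.* recip B B>0
  scale-pos B B>0 {ε} 0<ε = ℚₚ.positive⁻¹ (ε ℚ.* recip B B>0)
    {{ℚₚ.pos*pos⇒pos ε {{ℚ.positive 0<ε}} (recip B B>0) {{ℚₚ.1/pos⇒pos B {{B>0}}}}}}

  scale-cancel : ∀ B B>0 ε → ε ℚ.* recip B B>0 ℚ.* B ≡ ε
  scale-cancel B B>0 ε =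
    trans (ℚₚ.*-assoc ε (recip B B>0) B)
      (trans (cong (ε ℚ.*_) (ℚₚ.*-inverseˡ B {{ℚₚ.pos⇒nonZero B {{B>0}}}})) (ℚₚ.*-identityʳ ε))

  ∣*∣<-scale : ∀ B B>0 {ε} a b → ∣ a ∣ ℚ.< ε ℚ.* recip B B>0 → ∣ b ∣ ℚ.≤ B → ∣ a ℚ.* b ∣ ℚ.< ε
  ∣*∣<-scale B B>0 {ε} a b a< b≤ =
    subst (ℚ._< ε) (sym (ℚₚ.∣p*q∣≡∣p∣*∣q∣ a b))
      (ℚₚ.≤-<-trans (ℚₚ.*-monoˡ-≤-nonNeg ∣ a ∣ {{ℚₚ.∣-∣-nonNeg a}} b≤)
        (subst (∣ a ∣ ℚ.* B ℚ.<_) (scale-cancel B B>0 ε) (ℚₚ.*-monoˡ-<-pos B {{B>0}} a<)))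

  *-close : ∀ {ε} B B>0 C C>0 a b c d →
    ∣ a ∣ ℚ.≤ B → ∣ d ∣ ℚ.≤ C →
    ∣ a ℚ.- b ∣ ℚ.< ε ℚ.* ½ ℚ.* recip C C>0 → ∣ c ℚ.- d ∣ ℚ.< ε ℚ.* ½ ℚ.* recip B B>0 →
    ∣ a ℚ.* c ℚ.- b ℚ.* d ∣ ℚ.< ε
  *-close {ε} B B>0 C C>0 a b c d a≤ d≤ ab< cd< =
    subst (λ r → ∣ r ∣ ℚ.< ε) (rearrange-* a b c d)
      (∣+∣<-halves ((a ℚ.- b) ℚ.* d) ((c ℚ.- d) ℚ.* a)
        (∣*∣<-scale C C>0 (a ℚ.- b) d ab< d≤)
        (∣*∣<-scale B B>0 (c ℚ.- d) a cd< a≤))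

  *-cauchy-bounded : ∀ {f g} B (B>0 : ℚ.Positive B) C (C>0 : ℚ.Positive C) →
    EventuallyBounded f B → EventuallyBounded g C →
    IsCauchy f → IsCauchy g → IsCauchy (λ n → f n ℚ.* g n)
  *-cauchy-bounded {f} {g} B B>0 C C>0 (N₁ , f≤B) (N₂ , g≤C) cf cg ε 0<ε =
    combine (cf (ε ℚ.* ½ ℚ.* recip C C>0) (scale-pos C C>0 (half-pos 0<ε)))
            (cg (ε ℚ.* ½ ℚ.* recip B B>0) (scale-pos B B>0 (half-pos 0<ε)))
    where
    combine :
      Σ[ N ∈ ℕ ] (∀ m n → N ℕ.≤ m → N ℕ.≤ n → ∣ f m ℚ.- f n ∣ ℚ.< ε ℚ.* ½ ℚ.* recip C C>0) →
      Σ[ N ∈ ℕ ] (∀ m n → N ℕ.≤ m → N ℕ.≤ n → ∣ g m ℚ.- g n ∣ ℚ.< ε ℚ.* ½ ℚ.* recip B B>0) →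
      Σ[ N ∈ ℕ ] (∀ m n → N ℕ.≤ m → N ℕ.≤ n → ∣ f m ℚ.* g m ℚ.- f n ℚ.* g n ∣ ℚ.< ε)
    combine (N₃ , p) (N₄ , q) = (N₁ ℕ.⊔ N₂) ℕ.⊔ (N₃ ℕ.⊔ N₄) , λ m n N≤m N≤n →
      let N₁₂≤m = ℕₚ.m⊔n≤o⇒m≤o (N₁ ℕ.⊔ N₂) (N₃ ℕ.⊔ N₄) N≤m
          N₃₄≤m = ℕₚ.m⊔n≤o⇒n≤o (N₁ ℕ.⊔ N₂) (N₃ ℕ.⊔ N₄) N≤m
          N₁₂≤n = ℕₚ.m⊔n≤o⇒m≤o (N₁ ℕ.⊔ N₂) (N₃ ℕ.⊔ N₄) N≤n
          N₃₄≤n = ℕₚ.m⊔n≤o⇒n≤o (N₁ ℕ.⊔ N₂) (N₃ ℕ.⊔ N₄) N≤n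
      in *-close B B>0 C C>0 (f m) (f n) (g m) (g n)
           (f≤B m (ℕₚ.m⊔n≤o⇒m≤o N₁ N₂ N₁₂≤m))
           (g≤C n (ℕₚ.m⊔n≤o⇒n≤o N₁ N₂ N₁₂≤n))
           (p m n (ℕₚ.m⊔n≤o⇒m≤o N₃ N₄ N₃₄≤m) (ℕₚ.m⊔n≤o⇒m≤o N₃ N₄ N₃₄≤n))
           (q m n (ℕₚ.m⊔n≤o⇒n≤o N₃ N₄ N₃₄≤m) (ℕₚ.m⊔n≤o⇒n≤o N₃ N₄ N₃₄≤n))

  abstract
    *-cauchy : ∀ {f g} → IsCauchy f → IsCauchy g → IsCauchy (λ n → f n ℚ.* g n)
    *-cauchy {f} {g} cf cg =
      let B , B>0 , f≤B = eventually-bounded {f} cf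
          C , C>0 , g≤C = eventually-bounded {g} cg
      in *-cauchy-bounded {f} {g} B B>0 C C>0 f≤B g≤C cf cg

open CauchyLemmas

infixl 6 _+_ _-_
infixl 7 _*_
infix  8 -_

0ℝ 1ℝ : ℝ
0ℝ = mkℝ (λ _ → 0ℚ) (const-cauchy 0ℚ)
1ℝ = mkℝ (λ _ → 1ℚ) (const-cauchy 1ℚ)

_+_ _*_ : ℝ → ℝ → ℝ
x + y = mkℝ (λ n → seq x n ℚ.+ seq y n) (+-cauchy {seq x} {seq y} (cauchy x) (cauchy y))
x * y = mkℝ (λ n → seq x n ℚ.* seq y n) (*-cauchy {seq x} {seq y} (cauchy x) (cauchy y))

-_ : ℝ → ℝ
- x = mkℝ (λ n → ℚ.- seq x n) (neg-cauchy {seq x} (cauchy x))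

_-_ : ℝ → ℝ → ℝ
x - y = x + (- y)

ℝ-rawRing : RawRing 0ℓ 0ℓ
ℝ-rawRing = record
  { Carrier = ℝ ; _≈_ = _≃_ ; _+_ = _+_ ; _*_ = _*_ ; -_ = -_ ; 0# = 0ℝ ; 1# = 1ℝ }

open RawMonoidDefs (RawRing.+-rawMonoid ℝ-rawRing) public
  using () renaming (sum to ∑)
open RawMonoidDefs (RawRing.*-rawMonoid ℝ-rawRing) public
  using () renaming (sum to ∏)

Vec : ℕ → Set
Vec n = Vector ℝ n

Mat : ℕ → Set
Mat n = Fin n → Fin n → ℝ

private variable
  n : ℕ

infix 4 _≃ⱽ_ _≃ᴹ_

_≃ⱽ_ : Vec n → Vec n → Set
u ≃ⱽ v = ∀ i → u i ≃ v i

_≃ᴹ_ : Mat n → Mat n → Set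
A ≃ᴹ B = ∀ i j → A i j ≃ B i j

0ⱽ : Vec n
0ⱽ _ = 0ℝ

diag : Vec n → Mat n
diag δ i j = if does (i ≟ᶠ j) then δ i else 0ℝ

1ᴹ : Mat n
1ᴹ = diag (λ _ → 1ℝ)

infixl 6 _-ᴹ_
infixl 7 _*ᴹ_
infixr 7 _*ⱽ_ _·ⱽ_

_-ᴹ_ : Mat n → Mat n → Mat n
(A -ᴹ B) i j = A i j - B i j

_*ᴹ_ : Mat n → Mat n → Mat n
(A *ᴹ B) i j = ∑ (λ k → A i k * B k j)

_*ⱽ_ : Mat n → Vec n → Vec n
(A *ⱽ v) i = ∑ (λ k → A i k * v k)

_·ⱽ_ : ℝ → Vec n → Vec n
(c ·ⱽ v) i = c * v i

lincomb : ∀ {k} → Vec k → (Fin k → Vec n) → Vec n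
lincomb c b i = ∑ (λ j → c j * b j i)

LinearlyIndependent : ∀ {k} → (Fin k → Vec n) → Set
LinearlyIndependent b = ∀ c → lincomb c b ≃ⱽ 0ⱽ → c ≃ⱽ 0ⱽ

-- Intended for linear subspaces W of ℝⁿ.
HasDimension : Pred (Vec n) 0ℓ → ℕ → Set
HasDimension {n} W k =
  Σ[ b ∈ (Fin k → Vec n) ]
    (∀ j → b j ∈ W) × LinearlyIndependent b × (∀ w → w ∈ W → ∃[ c ] w ≃ⱽ lincomb c b)

Nonnegative : Mat n → Set
Nonnegative A = ∀ i j → 0ℝ ≤ A i j

Eigenspace : Mat n → ℝ → Pred (Vec n) 0ℓ
Eigenspace A θ v = A *ⱽ v ≃ⱽ θ ·ⱽ v

IsEigenvalue : Mat n → ℝ → Set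
IsEigenvalue A θ = ∃[ v ] v ∈ Eigenspace A θ × ∃[ i ] v i # 0ℝ

Diagonalizable : Mat n → Set
Diagonalizable {n} A =
  Σ[ P ∈ Mat n ] Σ[ P⁻¹ ∈ Mat n ] Σ[ δ ∈ Vec n ]
    (P *ᴹ P⁻¹ ≃ᴹ 1ᴹ) × (P⁻¹ *ᴹ P ≃ᴹ 1ᴹ) × (P⁻¹ *ᴹ A *ᴹ P ≃ᴹ diag δ)

MultiplicityFree : Mat n → Set
MultiplicityFree A = Diagonalizable A × (∀ θ → IsEigenvalue A θ → HasDimension (Eigenspace A θ) 1)

-- θ lists every eigenvalue of A exactly once.
record IsEigenvalueOrdering (A : Mat n) (θ : Fin n → ℝ) : Set where
  field
    distinct   : Injective _≡_ _≃_ θ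
    eigenvalue : ∀ i → IsEigenvalue A (θ i)
    exhaustive : ∀ x → IsEigenvalue A x → ∃[ i ] x ≃ θ i

record IsPrimitiveIdempotent (A : Mat n) (θ : Fin n → ℝ) (i : Fin n) (E : Mat n) : Set where
  field
    fixes       : ∀ v → v ∈ Eigenspace A (θ i) → (E -ᴹ 1ᴹ) *ⱽ v ≃ⱽ 0ⱽ
    annihilates : ∀ j → j ≢ i → ∀ v → v ∈ Eigenspace A (θ j) → E *ⱽ v ≃ⱽ 0ⱽ

-- (θᵢ-θ₀)⋯(θᵢ-θᵢ₋₁)(θᵢ-θᵢ₊₁)⋯(θᵢ-θ_d)
differenceProduct : ∀ {d} → (Fin (suc d) → ℝ) → Fin (suc d) → ℝ
differenceProduct θ i = ∏ (removeAt (λ j → θ i - θ j) i)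

-- Arcs and paths of Γ(A).
Arc : Mat n → Fin n → Fin n → Set
Arc A i j = i ≢ j × A i j # 0ℝ

data Path (A : Mat n) : Fin n → Fin n → ℕ → Set where
  []  : ∀ {s} → Path A s s zero
  _∷_ : ∀ {s r t ℓ} → Arc A s r → Path A r t ℓ → Path A s t (suc ℓ)

-- The distance is partial (t may be unreachable from s), hence a relation.
Distance : Mat n → Fin n → Fin n → ℕ → Set
Distance A s t ℓ = Path A s t ℓ × (∀ k → k ℕ.< ℓ → ¬ Path A s t k)

{-# OPTIONS --safe #-}
module Submission where

-- Write A = P diag(δ) Q with Q = P⁻¹. Then (Aᵏ)ₛₜ = Σᵢ wᵢ δᵢᵏ is the k-th moment of the nodes δᵢ with
-- weights wᵢ = Pₛᵢ Qᵢₜ, and wᵢ is the (s,t)-entry of the i-th primitive idempotent. As A is nonnegative,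
-- ∂(s,t) = d says exactly that (Aᵏ)ₛₜ = 0 for k < d and (Aᵈ)ₛₜ ≠ 0. If so, pairing the weights with the
-- monic polynomial ∏_{j≠i}(x - δⱼ) of degree d gives wᵢ ∏_{j≠i}(δᵢ - δⱼ) = (Aᵈ)ₛₜ, and since this is
-- nonzero the δᵢ are distinct. Conversely, weights with wᵢ ∏_{j≠i}(δᵢ - δⱼ) = c for all i are those of a
-- divided difference, so their moments below d vanish and the d-th one is c.
--
-- Constructively, all case distinctions on reals reduce to tightness (¬ x # 0 implies x ≃ 0) and to
-- the fact that one of the summands of a sum apart from 0 is apart from 0.

open import Defs
open import Level using (0ℓ)
open import Algebra.Bundles using (CommutativeRing)
open import Algebra.Bundles.Raw using (RawRing)
import Algebra.Definitions.RawSemiring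
import Algebra.Properties.CommutativeMonoid.Sum
import Algebra.Properties.CommutativeSemigroup
import Algebra.Properties.Group
import Algebra.Properties.Ring
import Algebra.Properties.Semiring.Sum
open import Data.Fin.Base using (Fin; zero; suc; punchIn; punchOut)
open import Data.Fin.Permutation using (permutation)
open import Data.Fin.Properties using (punchInᵢ≢i; punchIn-punchOut) renaming (_≟_ to _≟ᶠ_)
open import Data.Nat.Base as ℕ using (ℕ; zero; suc; z≤n; s≤s)
import Data.Nat.Properties as ℕₚ
open import Data.Product.Base using (Σ-syntax; ∃-syntax; _×_; _,_; proj₁; proj₂)
open import Data.Rational.Base as ℚ using (ℚ; 0ℚ; 1ℚ; ½; ∣_∣)
import Data.Rational.Properties as ℚₚ
open import Data.Rational.Solver using (module +-*-Solver)
open import Data.Sum.Base using (_⊎_; inj₁; inj₂; [_,_]′)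
open import Data.Vec.Functional using (removeAt; tail)
open import Function.Base using (_∘_)
open import Function.Bundles using (_⇔_; mk⇔)
open import Function.Definitions using (Injective)
open import Relation.Binary.Definitions using (Reflexive; Symmetric; Transitive)
open import Relation.Binary.PropositionalEquality as ≡ using (_≡_; _≢_; cong; subst)
open import Relation.Nullary using (¬_; Dec; yes; no)
open import Relation.Nullary.Decidable using (dec-true; dec-false)
open import Relation.Nullary.Negation using (contradiction)
open import Relation.Unary using (_∈_)
import Relation.Binary.Reasoning.Setoid
open CauchyLemmas

-- Inequalities and absolute values in ℚ.

private
  open +-*-Solver

  -- Reduces linear inequalities to ring identities: the known bounds are added up to `a ≤ b`, and
  -- the solver checks that the target has the same difference of sides.
  ≤-by-difference : ∀ {a b x y} → a ℚ.≤ b → b ℚ.- a ≡ y ℚ.- x → x ℚ.≤ y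
  ≤-by-difference {a} {b} {x} {y} a≤b eq =
    subst (x ℚ.≤_) (≡.trans (cong (λ z → x ℚ.+ z) eq) (solve 2 (λ x y → x :+ (y :- x) := y) ≡.refl x y))
      (subst (ℚ._≤ x ℚ.+ (b ℚ.- a))
        (solve 2 (λ x a → x :+ (a :- a) := x) ≡.refl x a)
        (ℚₚ.+-monoʳ-≤ x (ℚₚ.+-monoˡ-≤ (ℚ.- a) a≤b)))

  p≤∣p∣ : ∀ p → p ℚ.≤ ∣ p ∣
  p≤∣p∣ p with ℚₚ.≤-total 0ℚ p
  ... | inj₁ 0≤p = ℚₚ.≤-reflexive (≡.sym (ℚₚ.0≤p⇒∣p∣≡p 0≤p))
  ... | inj₂ p≤0 = ℚₚ.≤-trans p≤0 (ℚₚ.0≤∣p∣ p)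

  -p≤∣p∣ : ∀ p → ℚ.- p ℚ.≤ ∣ p ∣
  -p≤∣p∣ p = subst (ℚ.- p ℚ.≤_) (ℚₚ.∣-p∣≡∣p∣ p) (p≤∣p∣ (ℚ.- p))

  p≤0⇒∣p∣≡-p : ∀ {p} → p ℚ.≤ 0ℚ → ∣ p ∣ ≡ ℚ.- p
  p≤0⇒∣p∣≡-p {p} p≤0 =
    ≡.trans (≡.sym (ℚₚ.∣-p∣≡∣p∣ p)) (ℚₚ.0≤p⇒∣p∣≡p (ℚₚ.neg-antimono-≤ p≤0))

  ∣-∣-sym : ∀ p q → ∣ p ℚ.- q ∣ ≡ ∣ q ℚ.- p ∣
  ∣-∣-sym p q = ≡.trans (≡.sym (ℚₚ.∣-p∣≡∣p∣ (p ℚ.- q)))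
    (cong ∣_∣ (solve 2 (λ p q → :- (p :- q) := q :- p) ≡.refl p q))

  ∣p∣-∣q∣≤∣p-q∣ : ∀ p q → ∣ p ∣ ℚ.- ∣ q ∣ ℚ.≤ ∣ p ℚ.- q ∣
  ∣p∣-∣q∣≤∣p-q∣ p q = ≤-by-difference
    (subst (λ r → ∣ r ∣ ℚ.≤ ∣ p ℚ.- q ∣ ℚ.+ ∣ q ∣) (cancel p q) (ℚₚ.∣p+q∣≤∣p∣+∣q∣ (p ℚ.- q) q))
    (solve 3 (λ a b c → (c :+ b) :- a := c :- (a :- b)) ≡.refl (∣ p ∣) (∣ q ∣) (∣ p ℚ.- q ∣))

  ∣∣p∣-∣q∣∣≤∣p-q∣ : ∀ p q → ∣ (∣ p ∣ ℚ.- ∣ q ∣) ∣ ℚ.≤ ∣ p ℚ.- q ∣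
  ∣∣p∣-∣q∣∣≤∣p-q∣ p q with ℚₚ.∣p∣≡p∨∣p∣≡-p (∣ p ∣ ℚ.- ∣ q ∣)
  ... | inj₁ eq = subst (ℚ._≤ ∣ p ℚ.- q ∣) (≡.sym eq) (∣p∣-∣q∣≤∣p-q∣ p q)
  ... | inj₂ eq = ≡.subst₂ ℚ._≤_
    (≡.trans (solve 2 (λ p q → q :- p := :- (p :- q)) ≡.refl (∣ p ∣) (∣ q ∣)) (≡.sym eq))
    (∣-∣-sym q p) (∣p∣-∣q∣≤∣p-q∣ q p)

  -- Reverse triangle inequality: ∣q∣ ≥ ∣p∣ - ∣p - q∣ ≥ 2r - r. Halving a radius thus pays for
  -- passing to a nearby term or to an equal real.
  perturb-∣∣ : ∀ {r} p q → r ℚ.+ r ℚ.≤ ∣ p ∣ → ∣ p ℚ.- q ∣ ℚ.< r → r ℚ.≤ ∣ q ∣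
  perturb-∣∣ {r} p q r+r≤∣p∣ ∣p-q∣<r = ≤-by-difference
    (ℚₚ.+-mono-≤ (ℚₚ.+-mono-≤ r+r≤∣p∣ (ℚₚ.<⇒≤ ∣p-q∣<r)) (∣p∣-∣q∣≤∣p-q∣ p q))
    (solve 4 (λ p q d r → (p :+ r) :+ d :- (((r :+ r) :+ d) :+ (p :- q)) := q :- r) ≡.refl
      (∣ p ∣) (∣ q ∣) (∣ p ℚ.- q ∣) r)

-- Reals as a commutative ring

-- The operations act termwise, so each ring law of ℝ is that of ℚ at every index; only the
-- congruences need estimates.
seq-≡⇒≃ : ∀ {x y} → (∀ n → seq x n ≡ seq y n) → x ≃ y
seq-≡⇒≃ {x} {y} eq = mk≃ λ ε 0<ε → 0 , λ n _ →
  subst (λ r → ∣ r ∣ ℚ.< ε)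
    (≡.trans (≡.sym (ℚₚ.+-inverseʳ (seq x n))) (cong (λ z → seq x n ℚ.- z) (eq n))) 0<ε

≃-refl : Reflexive _≃_
≃-refl = seq-≡⇒≃ λ _ → ≡.refl

≃-sym : Symmetric _≃_
≃-sym {x} {y} x≃y = mk≃ λ ε 0<ε →
  let N , p = ≃-close x≃y ε 0<ε
  in N , λ n N≤n → subst (ℚ._< ε) (∣-∣-sym (seq x n) (seq y n)) (p n N≤n)

≃-trans : Transitive _≃_
≃-trans {x} {y} {z} x≃y y≃z = mk≃ λ ε 0<ε →
  let N₁ , p = ≃-close x≃y (ε ℚ.* ½) (half-pos 0<ε)
      N₂ , q = ≃-close y≃z (ε ℚ.* ½) (half-pos 0<ε)
  in N₁ ℕ.⊔ N₂ , λ n N≤n →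
    subst (λ r → ∣ r ∣ ℚ.< ε)
      (solve 3 (λ x y z → (x :- y) :+ (y :- z) := x :- z) ≡.refl (seq x n) (seq y n) (seq z n))
      (∣+∣<-halves (seq x n ℚ.- seq y n) (seq y n ℚ.- seq z n)
        (p n (ℕₚ.m⊔n≤o⇒m≤o N₁ N₂ N≤n)) (q n (ℕₚ.m⊔n≤o⇒n≤o N₁ N₂ N≤n)))

+-cong : ∀ {x y u v} → x ≃ y → u ≃ v → x + u ≃ y + v
+-cong {x} {y} {u} {v} x≃y u≃v = mk≃ λ ε 0<ε →
  let N₁ , p = ≃-close x≃y (ε ℚ.* ½) (half-pos 0<ε)
      N₂ , q = ≃-close u≃v (ε ℚ.* ½) (half-pos 0<ε)
  in N₁ ℕ.⊔ N₂ , λ n N≤n →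
    subst (λ r → ∣ r ∣ ℚ.< ε) (rearrange-+ (seq x n) (seq y n) (seq u n) (seq v n))
      (∣+∣<-halves (seq x n ℚ.- seq y n) (seq u n ℚ.- seq v n)
        (p n (ℕₚ.m⊔n≤o⇒m≤o N₁ N₂ N≤n)) (q n (ℕₚ.m⊔n≤o⇒n≤o N₁ N₂ N≤n)))

-‿cong : ∀ {x y} → x ≃ y → - x ≃ - y
-‿cong {x} {y} x≃y = mk≃ λ ε 0<ε →
  let N , p = ≃-close x≃y ε 0<ε
  in N , λ n N≤n → subst (ℚ._< ε)
    (≡.trans (∣-∣-sym (seq x n) (seq y n))
      (cong ∣_∣ (solve 2 (λ x y → y :- x := (:- x) :- (:- y)) ≡.refl (seq x n) (seq y n))))
    (p n N≤n)

-- As xu - yv = (x - y)v + (u - v)x, bounds on x and v suffice.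
*-cong : ∀ {x y u v} → x ≃ y → u ≃ v → x * u ≃ y * v
*-cong {x} {y} {u} {v} x≃y u≃v =
  let B , B>0 , N₁ , x≤B = eventually-bounded {seq x} (cauchy x)
      C , C>0 , N₂ , v≤C = eventually-bounded {seq v} (cauchy v)
  in mk≃ λ ε 0<ε →
  let N₃ , p = ≃-close x≃y (ε ℚ.* ½ ℚ.* recip C C>0) (scale-pos C C>0 (half-pos 0<ε))
      N₄ , q = ≃-close u≃v (ε ℚ.* ½ ℚ.* recip B B>0) (scale-pos B B>0 (half-pos 0<ε))
  in (N₁ ℕ.⊔ N₂) ℕ.⊔ (N₃ ℕ.⊔ N₄) , λ n N≤n →
  let N₁₂≤n = ℕₚ.m⊔n≤o⇒m≤o (N₁ ℕ.⊔ N₂) (N₃ ℕ.⊔ N₄) N≤n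
      N₃₄≤n = ℕₚ.m⊔n≤o⇒n≤o (N₁ ℕ.⊔ N₂) (N₃ ℕ.⊔ N₄) N≤n
  in *-close B B>0 C C>0 (seq x n) (seq y n) (seq u n) (seq v n)
       (x≤B n (ℕₚ.m⊔n≤o⇒m≤o N₁ N₂ N₁₂≤n)) (v≤C n (ℕₚ.m⊔n≤o⇒n≤o N₁ N₂ N₁₂≤n))
       (p n (ℕₚ.m⊔n≤o⇒m≤o N₃ N₄ N₃₄≤n)) (q n (ℕₚ.m⊔n≤o⇒n≤o N₃ N₄ N₃₄≤n))

ℝ-commutativeRing : CommutativeRing 0ℓ 0ℓ
ℝ-commutativeRing = record
  { Carrier = ℝ ; _≈_ = _≃_ ; _+_ = _+_ ; _*_ = _*_ ; -_ = -_ ; 0# = 0ℝ ; 1# = 1ℝ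
  ; isCommutativeRing = record
    { isRing = record
      { +-isAbelianGroup = record
        { isGroup = record
          { isMonoid = record
            { isSemigroup = record
              { isMagma = record
                { isEquivalence = record
                  { refl = ≃-refl ; sym = ≃-sym ; trans = ≃-trans }
                ; ∙-cong = +-cong }
              ; assoc = λ x y z → seq-≡⇒≃ λ n → ℚₚ.+-assoc (seq x n) (seq y n) (seq z n) }
            ; identity = (λ x → seq-≡⇒≃ λ n → ℚₚ.+-identityˡ (seq x n))
                       , (λ x → seq-≡⇒≃ λ n → ℚₚ.+-identityʳ (seq x n)) }
          ; inverse = (λ x → seq-≡⇒≃ λ n → ℚₚ.+-inverseˡ (seq x n))
                    , (λ x → seq-≡⇒≃ λ n → ℚₚ.+-inverseʳ (seq x n))
          ; ⁻¹-cong = -‿cong }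
        ; comm = λ x y → seq-≡⇒≃ λ n → ℚₚ.+-comm (seq x n) (seq y n) }
      ; *-cong = *-cong
      ; *-assoc = λ x y z → seq-≡⇒≃ λ n → ℚₚ.*-assoc (seq x n) (seq y n) (seq z n)
      ; *-identity = (λ x → seq-≡⇒≃ λ n → ℚₚ.*-identityˡ (seq x n))
                   , (λ x → seq-≡⇒≃ λ n → ℚₚ.*-identityʳ (seq x n))
      ; distrib = (λ x y z → seq-≡⇒≃ λ n → ℚₚ.*-distribˡ-+ (seq x n) (seq y n) (seq z n))
                , (λ x y z → seq-≡⇒≃ λ n → ℚₚ.*-distribʳ-+ (seq x n) (seq y n) (seq z n)) }
    ; *-comm = λ x y → seq-≡⇒≃ λ n → ℚₚ.*-comm (seq x n) (seq y n) } }

-- Apartness from zero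

-- x # 0ℝ without the sign, so that ∣p*q∣≡∣p∣*∣q∣ replaces all sign case splits.
record BoundedAway (x : ℝ) : Set where
  constructor mkAway
  field
    radius     : ℚ
    radius-pos : 0ℚ ℚ.< radius
    start      : ℕ
    away       : ∀ n → start ℕ.≤ n → radius ℚ.≤ ∣ seq x n ∣

#0⇒away : ∀ {x} → x # 0ℝ → BoundedAway x
#0⇒away {x} (inj₁ (mk< g g>0 N bound)) = mkAway g g>0 N λ n N≤n →
  ℚₚ.≤-trans
    (≤-by-difference (bound n N≤n) (solve 2 (λ x g → con 0ℚ :- (x :+ g) := (:- x) :- g) ≡.refl (seq x n) g))
    (-p≤∣p∣ (seq x n))
#0⇒away {x} (inj₂ (mk< g g>0 N bound)) = mkAway g g>0 N λ n N≤n →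
  ℚₚ.≤-trans (subst (ℚ._≤ seq x n) (ℚₚ.+-identityˡ g) (bound n N≤n)) (p≤∣p∣ (seq x n))

-- Terms after K stay within half the radius of the K-th one, so they all share its sign, which is
-- decidable in ℚ.
away⇒#0 : ∀ {x} → BoundedAway x → x # 0ℝ
away⇒#0 {x} (mkAway q q>0 N q≤) with cauchy x (q ℚ.* ½) (half-pos q>0)
... | N′ , close = decide (ℚₚ.≤-total 0ℚ (seq x K))
  where
  K = N ℕ.⊔ N′
  r = q ℚ.* ½
  q≤K : r ℚ.+ r ℚ.≤ ∣ seq x K ∣
  q≤K = subst (ℚ._≤ ∣ seq x K ∣) (≡.sym (half+half q)) (q≤ K (ℕₚ.m≤m⊔n N N′))
  closeK : ∀ n → K ℕ.≤ n → ∣ seq x K ℚ.- seq x n ∣ ℚ.≤ r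
  closeK n K≤n = ℚₚ.<⇒≤ (close K n (ℕₚ.m≤n⊔m N N′) (ℕₚ.m⊔n≤o⇒n≤o N N′ K≤n))
  decide : 0ℚ ℚ.≤ seq x K ⊎ seq x K ℚ.≤ 0ℚ → x # 0ℝ
  decide (inj₁ 0≤xK) = inj₂ (mk< r (half-pos q>0) K λ n K≤n → ≤-by-difference
    (ℚₚ.+-mono-≤ (subst (r ℚ.+ r ℚ.≤_) (ℚₚ.0≤p⇒∣p∣≡p 0≤xK) q≤K)
      (ℚₚ.≤-trans (p≤∣p∣ (seq x K ℚ.- seq x n)) (closeK n K≤n)))
    (solve 3 (λ k x r → (k :+ r) :- ((r :+ r) :+ (k :- x)) := x :- (con 0ℚ :+ r)) ≡.refl
      (seq x K) (seq x n) r))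
  decide (inj₂ xK≤0) = inj₁ (mk< r (half-pos q>0) K λ n K≤n → ≤-by-difference
    (ℚₚ.+-mono-≤ (subst (r ℚ.+ r ℚ.≤_) (p≤0⇒∣p∣≡-p xK≤0) q≤K)
      (ℚₚ.≤-trans (-p≤∣p∣ (seq x K ℚ.- seq x n)) (closeK n K≤n)))
    (solve 3 (λ k x r → ((:- k) :+ r) :- ((r :+ r) :+ (:- (k :- x))) := con 0ℚ :- (x :+ r)) ≡.refl
      (seq x K) (seq x n) r))

-- By the Cauchy property, one sufficiently late term decides apartness from zero.
late-term-away : ∀ x {q} → 0ℚ ℚ.< q →
  Σ[ N ∈ ℕ ] (∀ m → N ℕ.≤ m → q ℚ.≤ ∣ seq x m ∣ → BoundedAway x)
late-term-away x {q} q>0 with cauchy x (q ℚ.* ½) (half-pos q>0)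
... | N , close = N , λ m N≤m q≤ → mkAway (q ℚ.* ½) (half-pos q>0) N λ n N≤n →
  perturb-∣∣ (seq x m) (seq x n) (subst (ℚ._≤ ∣ seq x m ∣) (≡.sym (half+half q)) q≤)
    (close m n N≤m N≤n)

#0-resp-≃ : ∀ {x y} → x ≃ y → x # 0ℝ → y # 0ℝ
#0-resp-≃ {x} {y} x≃y x#0 with #0⇒away x#0
... | mkAway q q>0 N q≤ with ≃-close x≃y (q ℚ.* ½) (half-pos q>0)
... | N′ , close = away⇒#0 (mkAway (q ℚ.* ½) (half-pos q>0) (N ℕ.⊔ N′) λ n N≤n →
  perturb-∣∣ (seq x n) (seq y n)
    (subst (ℚ._≤ ∣ seq x n ∣) (≡.sym (half+half q)) (q≤ n (ℕₚ.m⊔n≤o⇒m≤o N N′ N≤n)))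
    (close n (ℕₚ.m⊔n≤o⇒n≤o N N′ N≤n)))

1#0 : 1ℝ # 0ℝ
1#0 = inj₂ (mk< 1ℚ (ℚₚ.positive⁻¹ 1ℚ) 0 λ _ _ → ℚₚ.≤-refl)

0#̸0 : ¬ 0ℝ # 0ℝ
0#̸0 0#0 with #0⇒away 0#0
... | mkAway q q>0 N q≤ = ℚₚ.<-irrefl ≡.refl (ℚₚ.<-≤-trans q>0 (q≤ N ℕₚ.≤-refl))

≃0⇒¬#0 : ∀ {x} → x ≃ 0ℝ → ¬ x # 0ℝ
≃0⇒¬#0 x≃0 x#0 = 0#̸0 (#0-resp-≃ x≃0 x#0)

-- A late term with ∣xₙ∣ ≥ ε would already prove apartness, so all late terms are smaller than ε.
#0-tight : ∀ {x} → ¬ x # 0ℝ → x ≃ 0ℝ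
#0-tight {x} ¬x#0 = mk≃ λ ε 0<ε →
  let N , late = late-term-away x 0<ε
  in N , λ n N≤n → small (late n N≤n)
  where
  small : ∀ {ε n} → (ε ℚ.≤ ∣ seq x n ∣ → BoundedAway x) → ∣ seq x n ℚ.- 0ℚ ∣ ℚ.< ε
  small {ε} {n} late with ε ℚₚ.≤? ∣ seq x n ∣
  ... | yes ε≤ = contradiction (away⇒#0 (late ε≤)) ¬x#0
  ... | no  ε≰ = subst (λ r → ∣ r ∣ ℚ.< ε) (≡.sym (ℚₚ.+-identityʳ (seq x n))) (ℚₚ.≰⇒> ε≰)

*-#0 : ∀ {x y} → x # 0ℝ → y # 0ℝ → x * y # 0ℝ
*-#0 {x} {y} x#0 y#0 with #0⇒away x#0 | #0⇒away y#0
... | mkAway q q>0 N q≤ | mkAway r r>0 N′ r≤ = away⇒#0 (mkAway (q ℚ.* r)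
  (ℚₚ.positive⁻¹ (q ℚ.* r) {{ℚₚ.pos*pos⇒pos q {{ℚ.positive q>0}} r {{ℚ.positive r>0}}}})
  (N ℕ.⊔ N′) λ n N≤n →
  subst (q ℚ.* r ℚ.≤_) (≡.sym (ℚₚ.∣p*q∣≡∣p∣*∣q∣ (seq x n) (seq y n)))
    (ℚₚ.≤-trans
      (ℚₚ.*-monoˡ-≤-nonNeg q {{ℚ.nonNegative (ℚₚ.<⇒≤ q>0)}} (r≤ n (ℕₚ.m⊔n≤o⇒n≤o N N′ N≤n)))
      (ℚₚ.*-monoʳ-≤-nonNeg ∣ seq y n ∣ {{ℚₚ.∣-∣-nonNeg (seq y n)}} (q≤ n (ℕₚ.m⊔n≤o⇒m≤o N N′ N≤n)))))

-- If eventually q ≤ ∣x∣∣y∣ and ∣y∣ ≤ B, then ∣x∣ ≥ q/B.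
*-#0⇒#0ˡ : ∀ {x y} → x * y # 0ℝ → x # 0ℝ
*-#0⇒#0ˡ {x} {y} xy#0 = bound (#0⇒away xy#0) (eventually-bounded {seq y} (cauchy y))
  where
  bound : BoundedAway (x * y) → Σ[ B ∈ ℚ ] ℚ.Positive B × EventuallyBounded (seq y) B → x # 0ℝ
  bound (mkAway q q>0 N q≤) (B , B>0 , N′ , y≤B) =
    away⇒#0 (mkAway (q ℚ.* recip B B>0) (scale-pos B B>0 q>0) (N ℕ.⊔ N′) λ n N≤n →
    ℚₚ.*-cancelʳ-≤-pos B {{B>0}}
      (subst (ℚ._≤ ∣ seq x n ∣ ℚ.* B) (≡.sym (scale-cancel B B>0 q))
        (ℚₚ.≤-trans
          (subst (q ℚ.≤_) (ℚₚ.∣p*q∣≡∣p∣*∣q∣ (seq x n) (seq y n)) (q≤ n (ℕₚ.m⊔n≤o⇒m≤o N N′ N≤n)))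
          (ℚₚ.*-monoˡ-≤-nonNeg ∣ seq x n ∣ {{ℚₚ.∣-∣-nonNeg (seq x n)}}
            (y≤B n (ℕₚ.m⊔n≤o⇒n≤o N N′ N≤n))))))

private
  ∣p∣≱r⇒r≤∣q∣ : ∀ {r} p q → r ℚ.+ r ℚ.≤ ∣ p ℚ.+ q ∣ → ¬ r ℚ.≤ ∣ p ∣ → r ℚ.≤ ∣ q ∣
  ∣p∣≱r⇒r≤∣q∣ {r} p q 2r≤ r≰ = ≤-by-difference
    (ℚₚ.+-mono-≤ (ℚₚ.≤-trans 2r≤ (ℚₚ.∣p+q∣≤∣p∣+∣q∣ p q)) (ℚₚ.<⇒≤ (ℚₚ.≰⇒> r≰)))
    (solve 3 (λ x y r → ((x :+ y) :+ r) :- ((r :+ r) :+ x) := y :- r) ≡.refl (∣ p ∣) (∣ q ∣) r)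

-- A single late index K decides: ∣x_K + y_K∣ ≥ q forces one of ∣x_K∣, ∣y_K∣ to be at least q/2, and
-- this is a comparison of rationals.
+-#0⇒⊎ : ∀ {x y} → x + y # 0ℝ → x # 0ℝ ⊎ y # 0ℝ
+-#0⇒⊎ {x} {y} x+y#0 with #0⇒away x+y#0
... | mkAway q q>0 N q≤ = split (late-term-away x (half-pos q>0)) (late-term-away y (half-pos q>0))
  where
  r = q ℚ.* ½
  Late : ℝ → Set
  Late z = Σ[ M ∈ ℕ ] (∀ m → M ℕ.≤ m → r ℚ.≤ ∣ seq z m ∣ → BoundedAway z)
  split : Late x → Late y → x # 0ℝ ⊎ y # 0ℝ
  split (N₁ , lateˣ) (N₂ , lateʸ) = decide (r ℚₚ.≤? ∣ seq x K ∣)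
    where
    K = N ℕ.⊔ (N₁ ℕ.⊔ N₂)
    K≥ : N₁ ℕ.⊔ N₂ ℕ.≤ K
    K≥ = ℕₚ.m≤n⊔m N (N₁ ℕ.⊔ N₂)
    decide : Dec (r ℚ.≤ ∣ seq x K ∣) → x # 0ℝ ⊎ y # 0ℝ
    decide (yes r≤) = inj₁ (away⇒#0 (lateˣ K (ℕₚ.m⊔n≤o⇒m≤o N₁ N₂ K≥) r≤))
    decide (no r≰) = inj₂ (away⇒#0 (lateʸ K (ℕₚ.m⊔n≤o⇒n≤o N₁ N₂ K≥)
      (∣p∣≱r⇒r≤∣q∣ (seq x K) (seq y K)
        (subst (ℚ._≤ ∣ seq x K ℚ.+ seq y K ∣) (≡.sym (half+half q)) (q≤ K (ℕₚ.m≤m⊔n N (N₁ ℕ.⊔ N₂)))) r≰)))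

-- Nonnegative reals.

-- A representative with nonnegative terms makes closure under + and * pointwise.
record NonNeg (x : ℝ) : Set where
  constructor mkNonNeg
  field
    representative : ℝ
    represents     : x ≃ representative
    terms-nonNeg   : ∀ n → 0ℚ ℚ.≤ seq representative n

0≤⇒nonNeg : ∀ {x} → 0ℝ ≤ x → NonNeg x
0≤⇒nonNeg {x} 0≤x = mkNonNeg ∣x∣ (mk≃ close) λ n → ℚₚ.0≤∣p∣ (seq x n)
  where
  ∣x∣ : ℝ
  ∣x∣ = mkℝ (λ n → ∣ seq x n ∣) λ ε 0<ε →
    let N , p = cauchy x ε 0<ε
    in N , λ m n N≤m N≤n → ℚₚ.≤-<-trans (∣∣p∣-∣q∣∣≤∣p-q∣ (seq x m) (seq x n)) (p m n N≤m N≤n)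
  -- For p ≤ 0 the distance from p to ∣p∣ is -2p, which is at most δ because p ≥ -δ/2.
  small : ∀ {δ} p → 0ℚ ℚ.< δ → 0ℚ ℚ.≤ p ℚ.+ δ ℚ.* ½ → ∣ (p ℚ.- ∣ p ∣) ∣ ℚ.≤ δ
  small {δ} p 0<δ 0≤p+ with ℚₚ.≤-total 0ℚ p
  ... | inj₁ 0≤p = subst (λ r → ∣ r ∣ ℚ.≤ δ)
    (≡.trans (≡.sym (ℚₚ.+-inverseʳ p)) (cong (λ z → p ℚ.- z) (≡.sym (ℚₚ.0≤p⇒∣p∣≡p 0≤p))))
    (ℚₚ.<⇒≤ 0<δ)
  ... | inj₂ p≤0 = subst (ℚ._≤ δ) (≡.sym ∣p-∣p∣∣≡-p-p)
    (≤-by-difference (ℚₚ.+-mono-≤ 0≤p+ 0≤p+)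
      (≡.trans
        (solve 2 (λ p h → ((p :+ h) :+ (p :+ h)) :- (con 0ℚ :+ con 0ℚ) := (h :+ h) :- (:- p :- p)) ≡.refl
          p (δ ℚ.* ½))
        (cong (λ z → z ℚ.- (ℚ.- p ℚ.- p)) (half+half δ))))
    where
    ∣p-∣p∣∣≡-p-p : ∣ (p ℚ.- ∣ p ∣) ∣ ≡ ℚ.- p ℚ.- p
    ∣p-∣p∣∣≡-p-p = ≡.trans (cong (λ z → ∣ p ℚ.- z ∣) (p≤0⇒∣p∣≡-p p≤0))
      (≡.trans (cong ∣_∣ (solve 1 (λ p → p :- (:- p) := p :+ p) ≡.refl p))
        (≡.trans (p≤0⇒∣p∣≡-p (ℚₚ.+-mono-≤ p≤0 p≤0)) (ℚₚ.neg-distrib-+ p p)))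
  close : ∀ ε → 0ℚ ℚ.< ε → Σ[ N ∈ ℕ ] (∀ n → N ℕ.≤ n → ∣ (seq x n ℚ.- ∣ seq x n ∣) ∣ ℚ.< ε)
  -- `small` gives a weak bound only, so it is applied to some δ strictly below ε.
  close ε 0<ε with ℚₚ.<-dense 0<ε
  ... | δ , 0<δ , δ<ε with ≤-bound 0≤x (δ ℚ.* ½) (half-pos 0<δ)
  ... | N , p = N , λ n N≤n → ℚₚ.≤-<-trans (small (seq x n) 0<δ (p n N≤n)) δ<ε

nonNeg-0 : NonNeg 0ℝ
nonNeg-0 = mkNonNeg 0ℝ ≃-refl λ _ → ℚₚ.≤-refl

nonNeg-1 : NonNeg 1ℝ
nonNeg-1 = mkNonNeg 1ℝ ≃-refl λ _ → ℚₚ.nonNegative⁻¹ 1ℚ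

nonNeg-+ : ∀ {x y} → NonNeg x → NonNeg y → NonNeg (x + y)
nonNeg-+ (mkNonNeg x′ x≃ 0≤x′) (mkNonNeg y′ y≃ 0≤y′) =
  mkNonNeg (x′ + y′) (+-cong x≃ y≃) λ n → ℚₚ.+-mono-≤ (0≤x′ n) (0≤y′ n)

nonNeg-* : ∀ {x y} → NonNeg x → NonNeg y → NonNeg (x * y)
nonNeg-* (mkNonNeg x′ x≃ 0≤x′) (mkNonNeg y′ y≃ 0≤y′) = mkNonNeg (x′ * y′) (*-cong x≃ y≃) λ n →
  ℚₚ.nonNegative⁻¹ (seq x′ n ℚ.* seq y′ n) {{ℚₚ.nonNeg*nonNeg⇒nonNeg
    (seq x′ n) {{ℚ.nonNegative (0≤x′ n)}} (seq y′ n) {{ℚ.nonNegative (0≤y′ n)}}}}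

private
  ∣p∣≤∣p+q∣ : ∀ p q → 0ℚ ℚ.≤ p → 0ℚ ℚ.≤ q → ∣ p ∣ ℚ.≤ ∣ p ℚ.+ q ∣
  ∣p∣≤∣p+q∣ p q 0≤p 0≤q = subst (ℚ._≤ ∣ p ℚ.+ q ∣) (≡.sym (ℚₚ.0≤p⇒∣p∣≡p 0≤p))
    (ℚₚ.≤-trans (subst (ℚ._≤ p ℚ.+ q) (ℚₚ.+-identityʳ p) (ℚₚ.+-monoʳ-≤ p 0≤q)) (p≤∣p∣ (p ℚ.+ q)))

-- Nonnegative terms cannot cancel, so the sum of the representatives keeps the radius of the first.
nonNeg-+-#0 : ∀ {x y} → NonNeg x → NonNeg y → x # 0ℝ → x + y # 0ℝ
nonNeg-+-#0 {x} {y} (mkNonNeg x′ x≃ 0≤x′) (mkNonNeg y′ y≃ 0≤y′) x#0 =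
  #0-resp-≃ {x′ + y′} {x + y} (≃-sym {x + y} {x′ + y′} (+-cong {x} {x′} {y} {y′} x≃ y≃))
    (enlarge (#0⇒away (#0-resp-≃ x≃ x#0)))
  where
  enlarge : BoundedAway x′ → x′ + y′ # 0ℝ
  enlarge (mkAway q q>0 N q≤) = away⇒#0 (mkAway q q>0 N λ n N≤n →
    ℚₚ.≤-trans (q≤ n N≤n) (∣p∣≤∣p+q∣ (seq x′ n) (seq y′ n) (0≤x′ n) (0≤y′ n)))

open CommutativeRing ℝ-commutativeRing using
  ( setoid; semiring; ring; +-group; +-commutativeSemigroup; *-commutativeSemigroup; *-commutativeMonoid
  ; reflexive; +-identityˡ; +-identityʳ; *-identityˡ; *-identityʳ; *-assoc; *-comm; zeroˡ; zeroʳ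
  ; +-congˡ; +-congʳ; *-congˡ; *-congʳ )
open Algebra.Definitions.RawSemiring (RawRing.rawSemiring ℝ-rawRing) using (_^_)
open Algebra.Properties.Semiring.Sum semiring using
  ( sum-cong-≋; sum-remove; sum-replicate-zero; sum-permute; ∑-comm; ∑-distrib-+
  ; *-distribˡ-sum; *-distribʳ-sum )
open Algebra.Properties.CommutativeMonoid.Sum *-commutativeMonoid using () renaming
  ( sum-remove to ∏-remove )
open Algebra.Properties.CommutativeSemigroup +-commutativeSemigroup using () renaming
  ( x∙yz≈y∙xz to x+[y+z]≃y+[x+z] )
open Algebra.Properties.CommutativeSemigroup *-commutativeSemigroup using () renaming
  ( x∙yz≈y∙xz to x*[y*z]≃y*[x*z]; interchange to *-interchange )
open Algebra.Properties.Group +-group using (∙-cancelˡ) renaming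
  ( x∙y⁻¹≈ε⇒x≈y to x-y≃0⇒x≃y; x≈y⇒x∙y⁻¹≈ε to x≃y⇒x-y≃0 )
open Algebra.Properties.Ring ring using ([y-z]x≈yx-zx; -1*x≈-x)
open Relation.Binary.Reasoning.Setoid setoid

private variable
  m n : ℕ

*-#0⇒#0ʳ : ∀ x y → x * y # 0ℝ → y # 0ℝ
*-#0⇒#0ʳ x y xy#0 = *-#0⇒#0ˡ {y} {x} (#0-resp-≃ (*-comm x y) xy#0)

-- No inverse is formed: `y # 0ℝ` would make the product apart from zero, and tightness concludes.
*≃0⇒≃0ʳ : ∀ {x y} → x # 0ℝ → x * y ≃ 0ℝ → y ≃ 0ℝ
*≃0⇒≃0ʳ {x} {y} x#0 xy≃0 = #0-tight λ y#0 → ≃0⇒¬#0 xy≃0 (*-#0 {x} {y} x#0 y#0)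

*-cancelʳ-#0 : ∀ x y {z} → z # 0ℝ → x * z ≃ y * z → x ≃ y
*-cancelʳ-#0 x y {z} z#0 xz≃yz = x-y≃0⇒x≃y x y (*≃0⇒≃0ʳ z#0 (begin
  z * (x - y)      ≈⟨ *-comm z (x - y) ⟩
  (x - y) * z      ≈⟨ [y-z]x≈yx-zx z x y ⟩
  x * z - y * z    ≈⟨ x≃y⇒x-y≃0 xz≃yz ⟩
  0ℝ               ∎))

-- Finite sums and products

∑-zero : (f : Vec n) → (∀ i → f i ≃ 0ℝ) → ∑ f ≃ 0ℝ
∑-zero {n} f f≃0 = ≃-trans (sum-cong-≋ f≃0) (sum-replicate-zero n)

∑-single : (f : Vec n) (i : Fin n) → (∀ j → j ≢ i → f j ≃ 0ℝ) → ∑ f ≃ f i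
∑-single {suc n} f i f≃0 = begin
  ∑ f                      ≈⟨ sum-remove {i = i} f ⟩
  f i + ∑ (removeAt f i)   ≈⟨ +-congˡ (∑-zero (removeAt f i) λ j → f≃0 (punchIn i j) (punchInᵢ≢i i j)) ⟩
  f i + 0ℝ                 ≈⟨ +-identityʳ (f i) ⟩
  f i                      ∎

∑-#0⇒∃ : (f : Vec n) → ∑ f # 0ℝ → ∃[ i ] f i # 0ℝ
∑-#0⇒∃ {zero}  f 0#0 = contradiction 0#0 0#̸0
∑-#0⇒∃ {suc n} f ∑f#0 = [ (λ f₀#0 → zero , f₀#0) , (λ ∑#0 → let i , fᵢ#0 = ∑-#0⇒∃ (tail f) ∑#0 in suc i , fᵢ#0) ]′
  (+-#0⇒⊎ {f zero} {∑ (tail f)} ∑f#0)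

∑-nonNeg : (f : Vec n) → (∀ i → NonNeg (f i)) → NonNeg (∑ f)
∑-nonNeg {zero}  f f≥0 = nonNeg-0
∑-nonNeg {suc n} f f≥0 = nonNeg-+ {f zero} {∑ (tail f)} (f≥0 zero) (∑-nonNeg (tail f) (f≥0 ∘ suc))

∑-nonNeg-#0 : (f : Vec n) → (∀ i → NonNeg (f i)) → ∀ i → f i # 0ℝ → ∑ f # 0ℝ
∑-nonNeg-#0 {suc n} f f≥0 i fi#0 = #0-resp-≃ {f i + ∑ (removeAt f i)} {∑ f} (≃-sym (sum-remove {i = i} f))
  (nonNeg-+-#0 {f i} {∑ (removeAt f i)} (f≥0 i) (∑-nonNeg (removeAt f i) (f≥0 ∘ punchIn i)) fi#0)

-- (aB)c = a(Bc) for a row a, a rectangular matrix B and a column c. This form covers matrix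
-- products, actions on vectors and moments alike.
∑-*-assoc : (a : Vec m) (B : Fin m → Fin n → ℝ) (c : Vec n) →
  ∑ (λ k → ∑ (λ l → a l * B l k) * c k) ≃ ∑ (λ l → a l * ∑ (λ k → B l k * c k))
∑-*-assoc a B c = begin
  ∑ (λ k → ∑ (λ l → a l * B l k) * c k)    ≈⟨ sum-cong-≋ (λ k → *-distribʳ-sum (c k) (λ l → a l * B l k)) ⟩
  ∑ (λ k → ∑ (λ l → a l * B l k * c k))    ≈⟨ ∑-comm (λ k l → a l * B l k * c k) ⟩
  ∑ (λ l → ∑ (λ k → a l * B l k * c k))    ≈⟨ sum-cong-≋ (λ l → sum-cong-≋ (λ k → *-assoc (a l) (B l k) (c k))) ⟩
  ∑ (λ l → ∑ (λ k → a l * (B l k * c k)))  ≈⟨ sum-cong-≋ (λ l → ≃-sym (*-distribˡ-sum (a l) (λ k → B l k * c k))) ⟩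
  ∑ (λ l → a l * ∑ (λ k → B l k * c k))    ∎

-- Serves to pass between (E - I)v = 0, the defining condition of an idempotent, and Ev = v.
-- Subtraction is treated as adding a multiple by -1.
∑-*-distrib-- : (a b v : Vec n) →
  ∑ (λ k → (a k - b k) * v k) ≃ ∑ (λ k → a k * v k) - ∑ (λ k → b k * v k)
∑-*-distrib-- a b v = begin
  ∑ (λ k → (a k - b k) * v k)
    ≈⟨ sum-cong-≋ (λ k → ≃-trans ([y-z]x≈yx-zx (v k) (a k) (b k)) (+-congˡ (≃-sym (-1*x≈-x (b k * v k))))) ⟩
  ∑ (λ k → a k * v k + (- 1ℝ) * (b k * v k))
    ≈⟨ ∑-distrib-+ (λ k → a k * v k) (λ k → (- 1ℝ) * (b k * v k)) ⟩
  ∑ (λ k → a k * v k) + ∑ (λ k → (- 1ℝ) * (b k * v k))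
    ≈⟨ +-congˡ (≃-sym (*-distribˡ-sum (- 1ℝ) (λ k → b k * v k))) ⟩
  ∑ (λ k → a k * v k) + (- 1ℝ) * ∑ (λ k → b k * v k)
    ≈⟨ +-congˡ (-1*x≈-x (∑ (λ k → b k * v k))) ⟩
  ∑ (λ k → a k * v k) - ∑ (λ k → b k * v k) ∎

∏-zero : (f : Vec n) (i : Fin n) → f i ≃ 0ℝ → ∏ f ≃ 0ℝ
∏-zero {suc n} f i fi≃0 = begin
  ∏ f                      ≈⟨ ∏-remove {i = i} f ⟩
  f i * ∏ (removeAt f i)   ≈⟨ *-congʳ fi≃0 ⟩
  0ℝ * ∏ (removeAt f i)    ≈⟨ zeroˡ _ ⟩
  0ℝ                       ∎

-- Diagonal matrices.

diag-≡ : (δ : Vec n) (i : Fin n) → diag δ i i ≡ δ i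
diag-≡ δ i rewrite dec-true (i ≟ᶠ i) ≡.refl = ≡.refl

diag-≢ : (δ : Vec n) {i j : Fin n} → i ≢ j → diag δ i j ≡ 0ℝ
diag-≢ δ {i} {j} i≢j rewrite dec-false (i ≟ᶠ j) i≢j = ≡.refl

diag-*ˡ : (δ : Vec n) (v : Vec n) (i : Fin n) → ∑ (λ k → diag δ i k * v k) ≃ δ i * v i
diag-*ˡ δ v i = ≃-trans
  (∑-single (λ k → diag δ i k * v k) i λ j j≢i →
    ≃-trans (*-congʳ (reflexive (diag-≢ δ (j≢i ∘ ≡.sym)))) (zeroˡ (v j)))
  (*-congʳ (reflexive (diag-≡ δ i)))

diag-*ʳ : (δ : Vec n) (v : Vec n) (j : Fin n) → ∑ (λ k → v k * diag δ k j) ≃ v j * δ j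
diag-*ʳ δ v j = ≃-trans
  (∑-single (λ k → v k * diag δ k j) j λ k k≢j →
    ≃-trans (*-congˡ (reflexive (diag-≢ δ k≢j))) (zeroʳ (v k)))
  (*-congˡ (reflexive (diag-≡ δ j)))

1ᴹ-*ˡ : (v : Vec n) (i : Fin n) → ∑ (λ k → 1ᴹ i k * v k) ≃ v i
1ᴹ-*ˡ v i = ≃-trans (diag-*ˡ (λ _ → 1ℝ) v i) (*-identityˡ (v i))

1ᴹ-*ʳ : (v : Vec n) (j : Fin n) → ∑ (λ k → v k * 1ᴹ k j) ≃ v j
1ᴹ-*ʳ v j = ≃-trans (diag-*ʳ (λ _ → 1ℝ) v j) (*-identityʳ (v j))

1ᴹ-#0⇒≡ : {i j : Fin n} → 1ᴹ i j # 0ℝ → i ≡ j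
1ᴹ-#0⇒≡ {i = i} {j} 1#0′ with i ≟ᶠ j
... | yes i≡j = i≡j
... | no  _   = contradiction 1#0′ 0#̸0

-- Moments of weighted nodes

moment : Vec n → Vec n → ℕ → ℝ
moment w x k = ∑ (λ i → w i * x i ^ k)

private
  -- Peels the factor x - r off a monic product; the solver works on the terms in ℚ.
  split-factor : ∀ w p x r q → w * p * ((x - r) * q) ≃ w * (x * p) * q + (- r) * (w * p * q)
  split-factor w p x r q = seq-≡⇒≃ λ n → identity (seq w n) (seq p n) (seq x n) (seq r n) (seq q n)
    where
    open +-*-Solver
    identity : ∀ w p x r q →
      w ℚ.* p ℚ.* ((x ℚ.- r) ℚ.* q) ≡ w ℚ.* (x ℚ.* p) ℚ.* q ℚ.+ (ℚ.- r) ℚ.* (w ℚ.* p ℚ.* q)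
    identity = solve 5 (λ w p x r q →
      w :* p :* ((x :- r) :* q) := w :* (x :* p) :* q :+ (:- r) :* (w :* p :* q)) ≡.refl

-- Low moments vanishing, the pairing of the weights with a monic polynomial of degree m sees
-- only its leading term.
moment-monic : (w x : Vec n) (r : Vec m) (k : ℕ) → (∀ j → j ℕ.< m ℕ.+ k → moment w x j ≃ 0ℝ) →
  ∑ (λ i → w i * x i ^ k * ∏ (λ l → x i - r l)) ≃ moment w x (m ℕ.+ k)
moment-monic {m = zero}  w x r k low = sum-cong-≋ λ i → *-identityʳ (w i * x i ^ k)
moment-monic {m = suc m} w x r k low = begin
  ∑ (λ i → w i * x i ^ k * ((x i - r zero) * q i))
    ≈⟨ sum-cong-≋ (λ i → split-factor (w i) (x i ^ k) (x i) (r zero) (q i)) ⟩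
  ∑ (λ i → w i * x i ^ suc k * q i + (- r zero) * (w i * x i ^ k * q i))
    ≈⟨ ∑-distrib-+ (λ i → w i * x i ^ suc k * q i) (λ i → (- r zero) * (w i * x i ^ k * q i)) ⟩
  ∑ (λ i → w i * x i ^ suc k * q i) + ∑ (λ i → (- r zero) * (w i * x i ^ k * q i))
    ≈⟨ +-cong highest (≃-sym (*-distribˡ-sum (- r zero) (λ i → w i * x i ^ k * q i))) ⟩
  moment w x (suc (m ℕ.+ k)) + (- r zero) * ∑ (λ i → w i * x i ^ k * q i)
    -- By induction the r₀ part is the moment of index m + k, still below suc m + k, so it vanishes.
    ≈⟨ +-congˡ (*-congˡ (≃-trans (moment-monic w x (tail r) k λ j j< → low j (ℕₚ.m<n⇒m<1+n j<))
         (low (m ℕ.+ k) (ℕₚ.n<1+n (m ℕ.+ k))))) ⟩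
  moment w x (suc (m ℕ.+ k)) + (- r zero) * 0ℝ
    ≈⟨ +-congˡ (zeroʳ (- r zero)) ⟩
  moment w x (suc (m ℕ.+ k)) + 0ℝ
    ≈⟨ +-identityʳ (moment w x (suc (m ℕ.+ k))) ⟩
  moment w x (suc (m ℕ.+ k)) ∎
  where
  q : Vec _
  q i = ∏ (λ l → x i - r (suc l))
  -- The factor x is absorbed into the power, so the induction is applied at exponent `suc k`; this
  -- is why the statement carries `k`.
  highest : ∑ (λ i → w i * x i ^ suc k * q i) ≃ moment w x (suc (m ℕ.+ k))
  highest = subst (λ e → ∑ (λ i → w i * x i ^ suc k * q i) ≃ moment w x e) (ℕₚ.+-suc m k)
    (moment-monic w x (tail r) (suc k) λ j j< → low j (subst (j ℕ.<_) (ℕₚ.+-suc m k) j<))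

-- The index j survives the removal of i, at position `punchOut i≢j`, and its factor is zero.
∏-difference-root : ∀ {d} (x : Vec (suc d)) {y i j} → i ≢ j → y ≃ x j → ∏ (λ l → y - x (punchIn i l)) ≃ 0ℝ
∏-difference-root x {y} {i} {j} i≢j y≃xⱼ = ∏-zero (λ l → y - x (punchIn i l)) (punchOut i≢j)
  (x≃y⇒x-y≃0 (≃-trans y≃xⱼ (reflexive (cong x (≡.sym (punchIn-punchOut i≢j))))))

-- With c apart from zero, this is the algebraic form of ∂(s,t) = d when M k is the (s,t)-entry of
-- Aᵏ.
record TopMoment (d : ℕ) (M : ℕ → ℝ) (c : ℝ) : Set where
  constructor mkTop
  field
    low : ∀ k → k ℕ.< d → M k ≃ 0ℝ
    top : M d ≃ c
open TopMoment

-- For distinct nodes, w is c times the coefficient vector of the divided difference at x₀, ...,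
-- x_d. The division is cleared, so the definition makes sense before the nodes are known to be
-- distinct.
LagrangeWeights : ∀ {d} → Vec (suc d) → Vec (suc d) → ℝ → Set
LagrangeWeights w x c = ∀ i → w i * differenceProduct x i ≃ c

-- The test polynomial ∏_{l≠i}(x - x_l) vanishes at every node of index other than i, so its pairing
-- with w is a single term; `moment-monic` evaluates the same pairing to the top moment.
moments⇒weights : ∀ {d} (w x : Vec (suc d)) {c} → TopMoment d (moment w x) c → LagrangeWeights w x c
moments⇒weights {d} w x {c} T i = begin
  -- The factor 1ℝ introduced here is the zeroth power of the node.
  w i * p i                          ≈⟨ *-congʳ (≃-sym (*-identityʳ (w i))) ⟩
  w i * 1ℝ * p i                     ≈⟨ ≃-sym (∑-single (λ j → w j * 1ℝ * p j) i
                                          λ j j≢i → ≃-trans (*-congˡ (∏-difference-root x (j≢i ∘ ≡.sym) ≃-refl))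
                                            (zeroʳ (w j * 1ℝ))) ⟩
  ∑ (λ j → w j * 1ℝ * p j)           ≈⟨ moment-monic w x (removeAt x i) 0
                                          (λ j j< → low T j (subst (j ℕ.<_) (ℕₚ.+-identityʳ d) j<)) ⟩
  moment w x (d ℕ.+ 0)               ≈⟨ reflexive (cong (moment w x) (ℕₚ.+-identityʳ d)) ⟩
  moment w x d                       ≈⟨ top T ⟩
  c                                  ∎
  where
  p : Vec _
  p j = ∏ (λ l → x j - x (punchIn i l))

-- Two equal nodes of different index would kill a factor of a difference product, yet that product
-- is apart from zero because c is.
weights⇒injective : ∀ {d} (w x : Vec (suc d)) {c} → c # 0ℝ → LagrangeWeights w x c → Injective _≡_ _≃_ x
weights⇒injective w x c#0 hyp {i} {j} xᵢ≃xⱼ = decide (i ≟ᶠ j)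
  where
  decide : Dec (i ≡ j) → i ≡ j
  decide (yes i≡j) = i≡j
  decide (no i≢j)  = contradiction
    (*-#0⇒#0ʳ (w i) (differenceProduct x i) (#0-resp-≃ (≃-sym (hyp i)) c#0))
    (≃0⇒¬#0 (∏-difference-root x i≢j xᵢ≃xⱼ))

-- Multiplying the weights by x - x₀ annihilates node 0, which is then dropped.
deleteHead : ∀ {d} → Vec (suc d) → Vec (suc d) → Vec d
deleteHead w x i = w (suc i) * (x (suc i) - x zero)

private
  delete-term : ∀ w p x r → w * (x * p) ≃ w * (x - r) * p + r * (w * p)
  delete-term w p x r = seq-≡⇒≃ λ n → identity (seq w n) (seq p n) (seq x n) (seq r n)
    where
    open +-*-Solver
    identity : ∀ w p x r → w ℚ.* (x ℚ.* p) ≡ w ℚ.* (x ℚ.- r) ℚ.* p ℚ.+ r ℚ.* (w ℚ.* p)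
    identity = solve 4 (λ w p x r → w :* (x :* p) := w :* (x :- r) :* p :+ r :* (w :* p)) ≡.refl

  delete-same : ∀ w p x → w * (x - x) * p ≃ 0ℝ
  delete-same w p x = seq-≡⇒≃ λ n → identity (seq w n) (seq p n) (seq x n)
    where
    open +-*-Solver
    identity : ∀ w p x → w ℚ.* (x ℚ.- x) ℚ.* p ≡ 0ℚ
    identity = solve 3 (λ w p x → w :* (x :- x) :* p := con 0ℚ) ≡.refl

-- Split x · xᵏ as (x - x₀)xᵏ + x₀xᵏ; the first part has no contribution from node 0.
moment-suc : ∀ {d} (w x : Vec (suc d)) k →
  moment w x (suc k) ≃ moment (deleteHead w x) (tail x) k + x zero * moment w x k
moment-suc w x k = begin
  moment w x (suc k)
    ≈⟨ sum-cong-≋ (λ i → delete-term (w i) (x i ^ k) (x i) (x zero)) ⟩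
  ∑ (λ i → w i * (x i - x zero) * x i ^ k + x zero * (w i * x i ^ k))
    ≈⟨ ∑-distrib-+ (λ i → w i * (x i - x zero) * x i ^ k) (λ i → x zero * (w i * x i ^ k)) ⟩
  ∑ (λ i → w i * (x i - x zero) * x i ^ k) + ∑ (λ i → x zero * (w i * x i ^ k))
    ≈⟨ +-cong (≃-trans (+-congʳ (delete-same (w zero) (x zero ^ k) (x zero)))
                (+-identityˡ (moment (deleteHead w x) (tail x) k)))
         (≃-sym (*-distribˡ-sum (x zero) (λ i → w i * x i ^ k))) ⟩
  moment (deleteHead w x) (tail x) k + x zero * moment w x k ∎

-- Brings node 1 to the front, so that `deleteHead` can remove it too.
swap₀₁ : ∀ {A : Set} {d} → (Fin (suc (suc d)) → A) → Fin (suc (suc d)) → A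
swap₀₁ v zero          = v (suc zero)
swap₀₁ v (suc zero)    = v zero
swap₀₁ v (suc (suc i)) = v (suc (suc i))

moment-swap : ∀ {d} (w x : Vec (suc (suc d))) k → moment (swap₀₁ w) (swap₀₁ x) k ≃ moment w x k
moment-swap w x k = x+[y+z]≃y+[x+z] (w (suc zero) * x (suc zero) ^ k) (w zero * x zero ^ k)
  (∑ (λ i → w (suc (suc i)) * x (suc (suc i)) ^ k))

-- At the two swapped indices the products agree definitionally; at any other index the first two
-- factors trade places.
weights-swap : ∀ {d} (w x : Vec (suc (suc d))) {c} →
  LagrangeWeights w x c → LagrangeWeights (swap₀₁ w) (swap₀₁ x) c
weights-swap w x hyp zero       = hyp (suc zero)
weights-swap w x hyp (suc zero) = hyp zero
weights-swap {suc d} w x hyp (suc (suc i)) = ≃-trans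
  (*-congˡ {w (suc (suc i))} (x*[y*z]≃y*[x*z] (y - x (suc zero)) (y - x zero) (∏ (λ l → y - x (suc (suc (punchIn i l)))))))
  (hyp (suc (suc i)))
  where
  y : ℝ
  y = x (suc (suc i))

-- The factor x_i - x₀ moves from the difference product into the weight, so c is unchanged.
weights-deleteHead : ∀ {d} (w x : Vec (suc (suc d))) {c} →
  LagrangeWeights w x c → LagrangeWeights (deleteHead w x) (tail x) c
weights-deleteHead w x hyp i = ≃-trans
  (*-assoc (w (suc i)) (x (suc i) - x zero) (∏ (λ l → x (suc i) - x (suc (punchIn i l)))))
  (hyp (suc i))

topMoment-unique₀ : ∀ d {M M′ c} → TopMoment d M c → TopMoment d M′ c → M 0 ≃ M′ 0
topMoment-unique₀ zero    T T′ = ≃-trans (top T) (≃-sym (top T′))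
topMoment-unique₀ (suc d) T T′ = ≃-trans (low T 0 (s≤s z≤n)) (≃-sym (low T′ 0 (s≤s z≤n)))

-- Deleting node 0 and deleting node 1 give M₁ = M′₀ + x₀M₀ and M₁ = M″₀ + x₁M₀ with M′₀ = M″₀ by
-- induction, hence M₀ = 0 since x₀ # x₁; the recurrence Mₖ₊₁ = M′ₖ + x₀Mₖ then yields the other moments.
weights⇒moments : ∀ {d} (w x : Vec (suc d)) {c} → c # 0ℝ → LagrangeWeights w x c → TopMoment d (moment w x) c
weights⇒moments {zero}  w x {c} c#0 hyp = mkTop (λ _ ()) (≃-trans (+-identityʳ (w zero * 1ℝ)) (hyp zero))
weights⇒moments {suc d} w x {c} c#0 hyp = mkTop vanish top′
  where
  M : ℕ → ℝ
  M = moment w x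
  w₁ x₁ : Vec (suc (suc d))
  w₁ = swap₀₁ w
  x₁ = swap₀₁ x
  T : TopMoment d (moment (deleteHead w x) (tail x)) c
  T = weights⇒moments (deleteHead w x) (tail x) c#0 (weights-deleteHead w x hyp)
  T₁ : TopMoment d (moment (deleteHead w₁ x₁) (tail x₁)) c
  T₁ = weights⇒moments (deleteHead w₁ x₁) (tail x₁) c#0 (weights-deleteHead w₁ x₁ (weights-swap w x hyp))
  -- The gap is the first factor of the difference product at index 0, which is apart from zero
  -- because c is.
  gap#0 : x zero - x (suc zero) # 0ℝ
  gap#0 = *-#0⇒#0ˡ {x zero - x (suc zero)} {∏ (λ l → x zero - x (suc (suc l)))}
    (*-#0⇒#0ʳ (w zero) (differenceProduct x zero) (#0-resp-≃ (≃-sym (hyp zero)) c#0))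
  twoWays : moment (deleteHead w x) (tail x) 0 + x zero * M 0 ≃
    moment (deleteHead w x) (tail x) 0 + x (suc zero) * M 0
  twoWays = begin
    moment (deleteHead w x) (tail x) 0 + x zero * M 0          ≈⟨ ≃-sym (moment-suc w x 0) ⟩
    M 1                                                        ≈⟨ ≃-sym (moment-swap w x 1) ⟩
    moment w₁ x₁ 1                                             ≈⟨ moment-suc w₁ x₁ 0 ⟩
    moment (deleteHead w₁ x₁) (tail x₁) 0 + x (suc zero) * moment w₁ x₁ 0
      ≈⟨ +-cong (topMoment-unique₀ d T₁ T) (*-congˡ (moment-swap w x 0)) ⟩
    moment (deleteHead w x) (tail x) 0 + x (suc zero) * M 0    ∎
  M₀≃0 : M 0 ≃ 0ℝ
  M₀≃0 = *≃0⇒≃0ʳ gap#0 (begin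
    (x zero - x (suc zero)) * M 0            ≈⟨ [y-z]x≈yx-zx (M 0) (x zero) (x (suc zero)) ⟩
    x zero * M 0 - x (suc zero) * M 0        ≈⟨ x≃y⇒x-y≃0
      (∙-cancelˡ (moment (deleteHead w x) (tail x) 0) (x zero * M 0) (x (suc zero) * M 0) twoWays) ⟩
    0ℝ                                       ∎)
  step : ∀ k {y} → moment (deleteHead w x) (tail x) k ≃ y → M k ≃ 0ℝ → M (suc k) ≃ y
  step k {y} eq Mₖ≃0 = begin
    M (suc k)                                               ≈⟨ moment-suc w x k ⟩
    moment (deleteHead w x) (tail x) k + x zero * M k       ≈⟨ +-cong eq (*-congˡ Mₖ≃0) ⟩
    y + x zero * 0ℝ                                         ≈⟨ +-congˡ (zeroʳ (x zero)) ⟩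
    y + 0ℝ                                                  ≈⟨ +-identityʳ y ⟩
    y                                                       ∎
  vanish : ∀ k → k ℕ.< suc d → M k ≃ 0ℝ
  vanish zero    _         = M₀≃0
  vanish (suc k) (s≤s k<d) = step k (low T k k<d) (vanish k (ℕₚ.m<n⇒m<1+n k<d))
  top′ : M (suc d) ≃ c
  top′ = step d (top T) (vanish d (ℕₚ.n<1+n d))

-- Powers of A and paths

infixr 8 _^ᴹ_

_^ᴹ_ : Mat n → ℕ → Mat n
A ^ᴹ zero  = 1ᴹ
A ^ᴹ suc k = A *ᴹ (A ^ᴹ k)

1ᴹ-nonNeg : (i j : Fin n) → NonNeg (1ᴹ i j)
1ᴹ-nonNeg i j with i ≟ᶠ j
... | yes _ = nonNeg-1
... | no  _ = nonNeg-0

^ᴹ-nonNeg : (A : Mat n) → Nonnegative A → ∀ k s t → NonNeg ((A ^ᴹ k) s t)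
^ᴹ-nonNeg A A≥0 zero    s t = 1ᴹ-nonNeg s t
^ᴹ-nonNeg A A≥0 (suc k) s t = ∑-nonNeg (λ r → A s r * (A ^ᴹ k) r t) λ r →
  nonNeg-* {A s r} {(A ^ᴹ k) r t} (0≤⇒nonNeg (A≥0 s r)) (^ᴹ-nonNeg A A≥0 k r t)

-- The path contributes one product of entries apart from zero, and nonnegativity keeps other walks
-- from cancelling it.
path⇒^ᴹ#0 : (A : Mat n) → Nonnegative A → ∀ {s t k} → Path A s t k → (A ^ᴹ k) s t # 0ℝ
path⇒^ᴹ#0 A A≥0 {s} [] = #0-resp-≃ (reflexive (≡.sym (diag-≡ (λ _ → 1ℝ) s))) 1#0
path⇒^ᴹ#0 A A≥0 {s} {t} (_∷_ {r = r} {ℓ = k} (_ , Asr#0) path) =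
  ∑-nonNeg-#0 (λ r′ → A s r′ * (A ^ᴹ k) r′ t)
    (λ r′ → nonNeg-* {A s r′} {(A ^ᴹ k) r′ t} (0≤⇒nonNeg (A≥0 s r′)) (^ᴹ-nonNeg A A≥0 k r′ t))
    r (*-#0 {A s r} {(A ^ᴹ k) r t} Asr#0 (path⇒^ᴹ#0 A A≥0 path))

-- Diagonal entries of A are loops, which are no arcs of Γ(A): dropping them shortens the walk.
^ᴹ#0⇒path : (A : Mat n) → ∀ k {s t} → (A ^ᴹ k) s t # 0ℝ → ∃[ ℓ ] ℓ ℕ.≤ k × Path A s t ℓ
^ᴹ#0⇒path A zero {s} {t} I#0 = 0 , z≤n , subst (λ r → Path A s r 0) (1ᴹ-#0⇒≡ I#0) []
^ᴹ#0⇒path A (suc k) {s} {t} Aᵏ#0 = prepend (∑-#0⇒∃ (λ r → A s r * (A ^ᴹ k) r t) Aᵏ#0)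
  where
  extend : ∀ r → Dec (s ≡ r) → A s r # 0ℝ → ∃[ ℓ ] ℓ ℕ.≤ k × Path A r t ℓ → ∃[ ℓ ] ℓ ℕ.≤ suc k × Path A s t ℓ
  extend r (yes ≡.refl) _     (ℓ , ℓ≤k , path) = ℓ , ℕₚ.m≤n⇒m≤1+n ℓ≤k , path
  extend r (no s≢r)     Asr#0 (ℓ , ℓ≤k , path) = suc ℓ , s≤s ℓ≤k , (s≢r , Asr#0) ∷ path
  prepend : ∃[ r ] A s r * (A ^ᴹ k) r t # 0ℝ → ∃[ ℓ ] ℓ ℕ.≤ suc k × Path A s t ℓ
  prepend (r , AsrAᵏ#0) = extend r (s ≟ᶠ r)
    (*-#0⇒#0ˡ {A s r} {(A ^ᴹ k) r t} AsrAᵏ#0)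
    (^ᴹ#0⇒path A k (*-#0⇒#0ʳ (A s r) ((A ^ᴹ k) r t) AsrAᵏ#0))

-- An entry of Aᵏ apart from zero with k < d would give a path shorter than d, so tightness makes it
-- vanish.
distance⇒topMoment : (A : Mat n) → Nonnegative A → ∀ {s t d} → Distance A s t d →
  (A ^ᴹ d) s t # 0ℝ × TopMoment d (λ k → (A ^ᴹ k) s t) ((A ^ᴹ d) s t)
distance⇒topMoment A A≥0 (path , shortest) = path⇒^ᴹ#0 A A≥0 path , mkTop
  (λ k k<d → #0-tight λ Aᵏ#0 →
    let ℓ , ℓ≤k , path′ = ^ᴹ#0⇒path A k Aᵏ#0 in shortest ℓ (ℕₚ.≤-<-trans ℓ≤k k<d) path′)
  ≃-refl

-- The d-th power yields a path of length at most d; a shorter one would make an earlier power apart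
-- from zero.
topMoment⇒distance : (A : Mat n) → Nonnegative A → ∀ {s t d c} → c # 0ℝ →
  TopMoment d (λ k → (A ^ᴹ k) s t) c → Distance A s t d
topMoment⇒distance A A≥0 {s} {t} {d} c#0 T =
  exact (^ᴹ#0⇒path A d (#0-resp-≃ (≃-sym (top T)) c#0)) , shortest
  where
  shortest : ∀ k → k ℕ.< d → ¬ Path A s t k
  shortest k k<d path = ≃0⇒¬#0 (low T k k<d) (path⇒^ᴹ#0 A A≥0 path)
  exact : ∃[ ℓ ] ℓ ℕ.≤ d × Path A s t ℓ → Path A s t d
  exact (ℓ , ℓ≤d , path) = [ (λ ℓ<d → contradiction path (shortest ℓ ℓ<d)) , (λ ℓ≡d → subst (Path A s t) ℓ≡d path) ]′
    (ℕₚ.m≤n⇒m<n∨m≡n ℓ≤d)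

-- Eigendecompositions

-- Columns of P are right eigenvectors and rows of Q the dual left eigenvectors; repetitions in δ
-- are allowed.
record Eigendecomposition (A P Q : Mat n) (δ : Vec n) : Set where
  field
    PQ≃1  : ∀ i j → ∑ (λ k → P i k * Q k j) ≃ 1ᴹ i j
    QP≃1  : ∀ i j → ∑ (λ k → Q i k * P k j) ≃ 1ᴹ i j
    AP≃Pδ : ∀ i j → ∑ (λ k → A i k * P k j) ≃ P i j * δ j
    QA≃δQ : ∀ i j → ∑ (λ k → Q i k * A k j) ≃ δ i * Q i j

-- AP = (PQ)AP = P(QAP), and dually QA = QA(PQ) = (QAP)Q.
eigendecomposition : (A P Q : Mat n) (δ : Vec n) →
  P *ᴹ Q ≃ᴹ 1ᴹ → Q *ᴹ P ≃ᴹ 1ᴹ → Q *ᴹ A *ᴹ P ≃ᴹ diag δ → Eigendecomposition A P Q δ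
eigendecomposition A P Q δ PQ QP QAP = record
  { PQ≃1 = PQ ; QP≃1 = QP ; AP≃Pδ = AP ; QA≃δQ = QA }
  where
  AP : ∀ i j → ∑ (λ k → A i k * P k j) ≃ P i j * δ j
  AP i j = begin
    (A *ᴹ P) i j                                       ≈⟨ ≃-sym (1ᴹ-*ˡ (λ l → (A *ᴹ P) l j) i) ⟩
    ∑ (λ l → 1ᴹ i l * (A *ᴹ P) l j)                    ≈⟨ sum-cong-≋ (λ l → *-congʳ (≃-sym (PQ i l))) ⟩
    ∑ (λ l → (P *ᴹ Q) i l * (A *ᴹ P) l j)              ≈⟨ ∑-*-assoc (P i) Q (λ l → (A *ᴹ P) l j) ⟩
    ∑ (λ k → P i k * ∑ (λ l → Q k l * (A *ᴹ P) l j))   ≈⟨ sum-cong-≋ (λ k → *-congˡ (≃-sym (∑-*-assoc (Q k) A (λ m → P m j)))) ⟩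
    ∑ (λ k → P i k * (Q *ᴹ A *ᴹ P) k j)                ≈⟨ sum-cong-≋ (λ k → *-congˡ (QAP k j)) ⟩
    ∑ (λ k → P i k * diag δ k j)                       ≈⟨ diag-*ʳ δ (P i) j ⟩
    P i j * δ j                                        ∎
  QA : ∀ i j → ∑ (λ k → Q i k * A k j) ≃ δ i * Q i j
  QA i j = begin
    (Q *ᴹ A) i j                                       ≈⟨ ≃-sym (1ᴹ-*ʳ ((Q *ᴹ A) i) j) ⟩
    ∑ (λ l → (Q *ᴹ A) i l * 1ᴹ l j)                    ≈⟨ sum-cong-≋ (λ l → *-congˡ (≃-sym (PQ l j))) ⟩
    ∑ (λ l → (Q *ᴹ A) i l * (P *ᴹ Q) l j)              ≈⟨ ≃-sym (∑-*-assoc ((Q *ᴹ A) i) P (λ k → Q k j)) ⟩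
    ∑ (λ k → (Q *ᴹ A *ᴹ P) i k * Q k j)                ≈⟨ sum-cong-≋ (λ k → *-congʳ (QAP i k)) ⟩
    ∑ (λ k → diag δ i k * Q k j)                       ≈⟨ diag-*ˡ δ (λ k → Q k j) i ⟩
    δ i * Q i j                                        ∎

Eigenspace-resp : (A : Mat n) {θ θ′ : ℝ} → θ ≃ θ′ → ∀ {v} → v ∈ Eigenspace A θ → v ∈ Eigenspace A θ′
Eigenspace-resp A θ≃θ′ v∈ i = ≃-trans (v∈ i) (*-congʳ θ≃θ′)

module Spectral {n} {A P Q : Mat n} {δ : Vec n} (D : Eigendecomposition A P Q δ) where
  open Eigendecomposition D

  column : Fin n → Vec n
  column j i = P i j

  -- The rank one product of column i of P and row i of Q, which is the i-th primitive idempotent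
  -- once δ is injective.
  component : Fin n → Mat n
  component i s t = P s i * Q i t

  ^ᴹ-moment : ∀ k s t → (A ^ᴹ k) s t ≃ moment (λ i → component i s t) δ k
  ^ᴹ-moment zero s t = begin
    1ᴹ s t                           ≈⟨ ≃-sym (PQ≃1 s t) ⟩
    ∑ (λ i → P s i * Q i t)          ≈⟨ sum-cong-≋ (λ i → ≃-sym (*-identityʳ (P s i * Q i t))) ⟩
    ∑ (λ i → P s i * Q i t * 1ℝ)     ∎
  ^ᴹ-moment (suc k) s t = begin
    ∑ (λ r → A s r * (A ^ᴹ k) r t)
      ≈⟨ sum-cong-≋ (λ r → *-congˡ (^ᴹ-moment k r t)) ⟩
    ∑ (λ r → A s r * ∑ (λ i → P r i * Q i t * δ i ^ k))
      ≈⟨ sum-cong-≋ (λ r → *-congˡ (sum-cong-≋ (λ i → *-assoc (P r i) (Q i t) (δ i ^ k)))) ⟩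
    ∑ (λ r → A s r * ∑ (λ i → P r i * (Q i t * δ i ^ k)))
      ≈⟨ ≃-sym (∑-*-assoc (A s) P (λ i → Q i t * δ i ^ k)) ⟩
    ∑ (λ i → ∑ (λ r → A s r * P r i) * (Q i t * δ i ^ k))
      ≈⟨ sum-cong-≋ (λ i → *-congʳ (AP≃Pδ s i)) ⟩
    ∑ (λ i → P s i * δ i * (Q i t * δ i ^ k))
      ≈⟨ sum-cong-≋ (λ i → *-interchange (P s i) (δ i) (Q i t) (δ i ^ k)) ⟩
    ∑ (λ i → P s i * Q i t * (δ i * δ i ^ k)) ∎

  topMoment-^ᴹ⇒δ : ∀ {s t d c} → TopMoment d (λ k → (A ^ᴹ k) s t) c →
    TopMoment d (moment (λ i → component i s t) δ) c
  topMoment-^ᴹ⇒δ {s} {t} {d} T = mkTop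
    (λ k k<d → ≃-trans (≃-sym (^ᴹ-moment k s t)) (low T k k<d))
    (≃-trans (≃-sym (^ᴹ-moment d s t)) (top T))

  topMoment-δ⇒^ᴹ : ∀ {s t d c} → TopMoment d (moment (λ i → component i s t) δ) c →
    TopMoment d (λ k → (A ^ᴹ k) s t) c
  topMoment-δ⇒^ᴹ {s} {t} {d} T = mkTop
    (λ k k<d → ≃-trans (^ᴹ-moment k s t) (low T k k<d))
    (≃-trans (^ᴹ-moment d s t) (top T))

  -- `Q *ⱽ v` holds the coordinates of v in the basis of eigenvectors given by P.
  coordinates-expand : ∀ v → v ≃ⱽ P *ⱽ (Q *ⱽ v)
  coordinates-expand v i = begin
    v i                                        ≈⟨ ≃-sym (1ᴹ-*ˡ v i) ⟩
    ∑ (λ l → 1ᴹ i l * v l)                     ≈⟨ sum-cong-≋ (λ l → *-congʳ (≃-sym (PQ≃1 i l))) ⟩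
    ∑ (λ l → ∑ (λ k → P i k * Q k l) * v l)    ≈⟨ ∑-*-assoc (P i) Q v ⟩
    ∑ (λ k → P i k * ∑ (λ l → Q k l * v l))    ∎

  coordinates-eigen : ∀ {θ v} → v ∈ Eigenspace A θ → ∀ i → θ * (Q *ⱽ v) i ≃ δ i * (Q *ⱽ v) i
  coordinates-eigen {θ} {v} v∈ i = begin
    θ * ∑ (λ k → Q i k * v k)                  ≈⟨ *-distribˡ-sum θ (λ k → Q i k * v k) ⟩
    ∑ (λ k → θ * (Q i k * v k))                ≈⟨ sum-cong-≋ (λ k → x*[y*z]≃y*[x*z] θ (Q i k) (v k)) ⟩
    ∑ (λ k → Q i k * (θ * v k))                ≈⟨ sum-cong-≋ (λ k → *-congˡ (≃-sym (v∈ k))) ⟩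
    ∑ (λ k → Q i k * ∑ (λ l → A k l * v l))    ≈⟨ ≃-sym (∑-*-assoc (Q i) A v) ⟩
    ∑ (λ l → ∑ (λ k → Q i k * A k l) * v l)    ≈⟨ sum-cong-≋ (λ l → *-congʳ (QA≃δQ i l)) ⟩
    ∑ (λ l → δ i * Q i l * v l)                ≈⟨ sum-cong-≋ (λ l → *-assoc (δ i) (Q i l) (v l)) ⟩
    ∑ (λ l → δ i * (Q i l * v l))              ≈⟨ ≃-sym (*-distribˡ-sum (δ i) (λ l → Q i l * v l)) ⟩
    δ i * ∑ (λ l → Q i l * v l)                ∎

  coordinate-#0⇒≃ : ∀ {θ v} → v ∈ Eigenspace A θ → ∀ i → (Q *ⱽ v) i # 0ℝ → θ ≃ δ i
  coordinate-#0⇒≃ {θ} {v} v∈ i coord#0 = *-cancelʳ-#0 θ (δ i) coord#0 (coordinates-eigen v∈ i)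

  -- An entry of v apart from zero exhibits a coordinate apart from zero, and its index is the one
  -- sought.
  eigenvalue⇒≃δ : ∀ θ → IsEigenvalue A θ → ∃[ j ] θ ≃ δ j
  eigenvalue⇒≃δ θ (v , v∈ , i , vᵢ#0) =
    let k , Pᵢₖcₖ#0 = ∑-#0⇒∃ (λ k → P i k * (Q *ⱽ v) k) (#0-resp-≃ (coordinates-expand v i) vᵢ#0)
    in k , coordinate-#0⇒≃ v∈ k (*-#0⇒#0ʳ (P i k) ((Q *ⱽ v) k) Pᵢₖcₖ#0)

  column∈ : ∀ j → column j ∈ Eigenspace A (δ j)
  column∈ j i = ≃-trans (AP≃Pδ i j) (*-comm (P i j) (δ j))

  QP#0 : ∀ j → ∑ (λ k → Q j k * P k j) # 0ℝ
  QP#0 j = #0-resp-≃ (≃-sym (≃-trans (QP≃1 j j) (reflexive (diag-≡ (λ _ → 1ℝ) j)))) 1#0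

  column-#0 : ∀ j → ∃[ k ] P k j # 0ℝ
  column-#0 j =
    let k , QP#0′ = ∑-#0⇒∃ (λ k → Q j k * P k j) (QP#0 j)
    in k , *-#0⇒#0ʳ (Q j k) (P k j) QP#0′

  δ-eigenvalue : ∀ j → IsEigenvalue A (δ j)
  δ-eigenvalue j = column j , column∈ j , column-#0 j

  -- Write E = (EP)Q: E kills all columns of P but the i-th, which it fixes.
  primitiveIdempotent⇒component : ∀ i E → IsPrimitiveIdempotent A δ i E → E ≃ᴹ component i
  primitiveIdempotent⇒component i E idem s t = begin
    E s t                                        ≈⟨ ≃-sym (1ᴹ-*ʳ (E s) t) ⟩
    ∑ (λ k → E s k * 1ᴹ k t)                     ≈⟨ sum-cong-≋ (λ k → *-congˡ (≃-sym (PQ≃1 k t))) ⟩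
    ∑ (λ k → E s k * ∑ (λ j → P k j * Q j t))    ≈⟨ ≃-sym (∑-*-assoc (E s) P (λ j → Q j t)) ⟩
    ∑ (λ j → ∑ (λ k → E s k * P k j) * Q j t)    ≈⟨ ∑-single (λ j → ∑ (λ k → E s k * P k j) * Q j t) i
                                                      (λ j j≢i → ≃-trans
                                                        (*-congʳ (annihilates j j≢i (column j) (column∈ j) s))
                                                        (zeroˡ (Q j t))) ⟩
    ∑ (λ k → E s k * P k i) * Q i t              ≈⟨ *-congʳ Ecolumn≃column ⟩
    P s i * Q i t                                ∎
    where
    open IsPrimitiveIdempotent idem
    Ecolumn≃column : ∑ (λ k → E s k * P k i) ≃ P s i
    Ecolumn≃column = ≃-trans
      (x-y≃0⇒x≃y (∑ (λ k → E s k * P k i)) (∑ (λ k → 1ᴹ s k * P k i))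
        (≃-trans (≃-sym (∑-*-distrib-- (E s) (1ᴹ s) (column i))) (fixes (column i) (column∈ i) s)))
      (1ᴹ-*ˡ (column i) s)

  -- If δᵢ = δⱼ, both columns are multiples of one vector b, and comparing coordinates forces the
  -- indices to agree.
  dimension-1⇒injective : (∀ θ → IsEigenvalue A θ → HasDimension (Eigenspace A θ) 1) → Injective _≡_ _≃_ δ
  dimension-1⇒injective dim {i} {j} δᵢ≃δⱼ = decide (i ≟ᶠ j) (dim (δ i) (δ-eigenvalue i))
    where
    coordinate-span : (c : Vec 1) (b : Fin 1 → Vec n) → ∀ k → column k ≃ⱽ lincomb c b →
      ∀ l → 1ᴹ l k ≃ c zero * (Q *ⱽ b zero) l
    coordinate-span c b k eq l = begin
      1ᴹ l k                                           ≈⟨ ≃-sym (QP≃1 l k) ⟩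
      ∑ (λ m → Q l m * P m k)                          ≈⟨ sum-cong-≋ (λ m → *-congˡ
                                                            (≃-trans (eq m) (+-identityʳ (c zero * b zero m)))) ⟩
      ∑ (λ m → Q l m * (c zero * b zero m))            ≈⟨ sum-cong-≋ (λ m → x*[y*z]≃y*[x*z] (Q l m) (c zero) (b zero m)) ⟩
      ∑ (λ m → c zero * (Q l m * b zero m))            ≈⟨ ≃-sym (*-distribˡ-sum (c zero) (λ m → Q l m * b zero m)) ⟩
      c zero * ∑ (λ m → Q l m * b zero m)              ∎
    1ᴹ#0 : ∀ k → 1ᴹ k k # 0ℝ
    1ᴹ#0 k = #0-resp-≃ (QP≃1 k k) (QP#0 k)
    decide : Dec (i ≡ j) → HasDimension (Eigenspace A (δ i)) 1 → i ≡ j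
    decide (yes i≡j) _ = i≡j
    decide (no i≢j) (b , _ , _ , span) =
      let c , colᵢ = span (column i) (column∈ i)
          c′ , colⱼ = span (column j) (Eigenspace-resp A (≃-sym δᵢ≃δⱼ) (column∈ j))
          -- With β = Qb, the diagonal entries 1 = cβᵢ and 1 = c′βⱼ show that c and βⱼ are apart
          -- from zero; hence so is cβⱼ, the (j,i)-entry of the identity.
          c#0 = *-#0⇒#0ˡ {c zero} {(Q *ⱽ b zero) i} (#0-resp-≃ (coordinate-span c b i colᵢ i) (1ᴹ#0 i))
          β#0 = *-#0⇒#0ʳ (c′ zero) ((Q *ⱽ b zero) j) (#0-resp-≃ (coordinate-span c′ b j colⱼ j) (1ᴹ#0 j))
      in ≡.sym (1ᴹ-#0⇒≡ (#0-resp-≃ (≃-sym (coordinate-span c b i colᵢ j)) (*-#0 c#0 β#0)))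

  -- Pairwise distinct eigenvalues.

  module Simple (δ-injective : Injective _≡_ _≃_ δ) where

    coordinate-≃0 : ∀ {j v} → v ∈ Eigenspace A (δ j) → ∀ {k} → k ≢ j → (Q *ⱽ v) k ≃ 0ℝ
    coordinate-≃0 v∈ {k} k≢j = #0-tight λ coord#0 →
      k≢j (≡.sym (δ-injective (coordinate-#0⇒≃ v∈ k coord#0)))

    eigenvector-multiple : ∀ {j v} → v ∈ Eigenspace A (δ j) → ∀ i → v i ≃ P i j * (Q *ⱽ v) j
    eigenvector-multiple {j} {v} v∈ i = ≃-trans (coordinates-expand v i)
      (∑-single (λ k → P i k * (Q *ⱽ v) k) j λ k k≢j →
        ≃-trans (*-congˡ (coordinate-≃0 v∈ k≢j)) (zeroʳ (P i k)))

    eigenspace-dimension : ∀ θ → IsEigenvalue A θ → HasDimension (Eigenspace A θ) 1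
    eigenspace-dimension θ θ-eig = build (eigenvalue⇒≃δ θ θ-eig)
      where
      build : ∃[ j ] θ ≃ δ j → HasDimension (Eigenspace A θ) 1
      build (j , θ≃δⱼ) = (λ _ → column j)
        , (λ _ → Eigenspace-resp A (≃-sym θ≃δⱼ) (column∈ j))
        , independent
        , λ w w∈ → (λ _ → (Q *ⱽ w) j) , λ i → begin
            w i                            ≈⟨ eigenvector-multiple (Eigenspace-resp A θ≃δⱼ w∈) i ⟩
            P i j * (Q *ⱽ w) j             ≈⟨ *-comm (P i j) ((Q *ⱽ w) j) ⟩
            (Q *ⱽ w) j * P i j             ≈⟨ ≃-sym (+-identityʳ ((Q *ⱽ w) j * P i j)) ⟩
            (Q *ⱽ w) j * P i j + 0ℝ        ∎
        where
        independent : LinearlyIndependent (λ (_ : Fin 1) → column j)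
        independent c c·col≃0 zero = #0-tight λ c#0 →
          let k , Pₖⱼ#0 = column-#0 j
          in ≃0⇒¬#0 (≃-trans (≃-sym (+-identityʳ (c zero * P k j))) (c·col≃0 k)) (*-#0 {c zero} {P k j} c#0 Pₖⱼ#0)

    δ-ordering : IsEigenvalueOrdering A δ
    δ-ordering = record { distinct = δ-injective ; eigenvalue = δ-eigenvalue ; exhaustive = eigenvalue⇒≃δ }

    component-*ⱽ : ∀ i v s → (component i *ⱽ v) s ≃ P s i * (Q *ⱽ v) i
    component-*ⱽ i v s = ≃-trans
      (sum-cong-≋ (λ k → *-assoc (P s i) (Q i k) (v k)))
      (≃-sym (*-distribˡ-sum (P s i) (λ k → Q i k * v k)))

    component-isPrimitiveIdempotent : ∀ i → IsPrimitiveIdempotent A δ i (component i)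
    component-isPrimitiveIdempotent i = record
      { fixes = λ v v∈ s → ≃-trans (∑-*-distrib-- (component i s) (1ᴹ s) v)
          (x≃y⇒x-y≃0 (≃-trans (component-*ⱽ i v s)
            (≃-trans (≃-sym (eigenvector-multiple v∈ s)) (≃-sym (1ᴹ-*ˡ v s)))))
      ; annihilates = λ j j≢i v v∈ s → ≃-trans (component-*ⱽ i v s)
          (≃-trans (*-congˡ (coordinate-≃0 v∈ (j≢i ∘ ≡.sym))) (zeroʳ (P s i)))
      }

    -- Passage to an arbitrary ordering of the eigenvalues.

    module Reorder {θ : Vec n} (θ-ordering : IsEigenvalueOrdering A θ) where
      open IsEigenvalueOrdering θ-ordering

      σ τ : Fin n → Fin n
      σ i = proj₁ (eigenvalue⇒≃δ (θ i) (eigenvalue i))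
      τ j = proj₁ (exhaustive (δ j) (δ-eigenvalue j))

      θ≃δσ : ∀ i → θ i ≃ δ (σ i)
      θ≃δσ i = proj₂ (eigenvalue⇒≃δ (θ i) (eigenvalue i))

      δ≃θτ : ∀ j → δ j ≃ θ (τ j)
      δ≃θτ j = proj₂ (exhaustive (δ j) (δ-eigenvalue j))

      στ : ∀ j → σ (τ j) ≡ j
      στ j = δ-injective (≃-trans (≃-sym (θ≃δσ (τ j))) (≃-sym (δ≃θτ j)))

      τσ : ∀ i → τ (σ i) ≡ i
      τσ i = distinct (≃-trans (≃-sym (δ≃θτ (σ i))) (≃-sym (θ≃δσ i)))

      1ᴹ-σ : ∀ i j → 1ᴹ (σ i) (σ j) ≃ 1ᴹ i j
      1ᴹ-σ i j = decide (i ≟ᶠ j)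
        where
        decide : Dec (i ≡ j) → 1ᴹ (σ i) (σ j) ≃ 1ᴹ i j
        decide (yes ≡.refl) = reflexive (≡.trans (diag-≡ (λ _ → 1ℝ) (σ i)) (≡.sym (diag-≡ (λ _ → 1ℝ) i)))
        decide (no i≢j) = reflexive (≡.trans
          (diag-≢ (λ _ → 1ℝ) (λ σi≡σj → i≢j (≡.trans (≡.sym (τσ i)) (≡.trans (cong τ σi≡σj) (τσ j)))))
          (≡.sym (diag-≢ (λ _ → 1ℝ) i≢j)))

      -- Permuting columns of P and rows of Q along `σ` carries the spectral results from δ to θ; PQ
      -- only has its summands permuted.
      reordered : Eigendecomposition A (λ i j → P i (σ j)) (λ i j → Q (σ i) j) θ
      reordered = record
        { PQ≃1 = λ i j → ≃-trans (≃-sym (sum-permute (λ k → P i k * Q k j) (permutation σ τ στ τσ))) (PQ≃1 i j)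
        ; QP≃1 = λ i j → ≃-trans (QP≃1 (σ i) (σ j)) (1ᴹ-σ i j)
        ; AP≃Pδ = λ i j → ≃-trans (AP≃Pδ i (σ j)) (*-congˡ (≃-sym (θ≃δσ j)))
        ; QA≃δQ = λ i j → ≃-trans (QA≃δQ (σ i) j) (*-congʳ (≃-sym (θ≃δσ i)))
        }

-- From distance to idempotents and back.

distance⇒idempotents : ∀ d (A : Mat (suc d)) → Nonnegative A → ∀ s t → Diagonalizable A → Distance A s t d →
  MultiplicityFree A ×
    ((θ : Fin (suc d) → ℝ) → IsEigenvalueOrdering A θ →
     (E : Fin (suc d) → Mat (suc d)) → (∀ i → IsPrimitiveIdempotent A θ i (E i)) →
     ∃[ c ] c # 0ℝ × (∀ i → E i s t * differenceProduct θ i ≃ c))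
distance⇒idempotents d A A≥0 s t A-diag@(P , Q , δ , PQ , QP , QAP) dist =
  (A-diag , eigenspace-dimension) , λ θ θ-ordering E idem →
  let module R = Spectral (Reorder.reordered θ-ordering)
  -- The common value is the (s,t)-entry of Aᵈ, obtained from the weights taken in the ordering θ.
  in (A ^ᴹ d) s t , c#0 , λ i → ≃-trans
       (*-congʳ (R.primitiveIdempotent⇒component i (E i) (idem i) s t))
       (moments⇒weights (λ j → R.component j s t) θ (R.topMoment-^ᴹ⇒δ T) i)
  where
  D : Eigendecomposition A P Q δ
  D = eigendecomposition A P Q δ PQ QP QAP
  open Spectral D
  c#0 : (A ^ᴹ d) s t # 0ℝ
  c#0 = proj₁ (distance⇒topMoment A A≥0 dist)
  T : TopMoment d (λ k → (A ^ᴹ k) s t) ((A ^ᴹ d) s t)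
  T = proj₂ (distance⇒topMoment A A≥0 dist)
  -- Distinctness of δ comes from the weights of the given diagonalization, before any ordering θ is
  -- considered.
  open Simple (weights⇒injective (λ i → component i s t) δ c#0
    (moments⇒weights (λ i → component i s t) δ (topMoment-^ᴹ⇒δ T)))

idempotents⇒distance : ∀ d (A : Mat (suc d)) → Nonnegative A → ∀ s t → MultiplicityFree A →
  ((θ : Fin (suc d) → ℝ) → IsEigenvalueOrdering A θ →
   (E : Fin (suc d) → Mat (suc d)) → (∀ i → IsPrimitiveIdempotent A θ i (E i)) →
   ∃[ c ] c # 0ℝ × (∀ i → E i s t * differenceProduct θ i ≃ c)) →
  Distance A s t d
idempotents⇒distance d A A≥0 s t ((P , Q , δ , PQ , QP , QAP) , dim) hyp =
  -- The hypothesis is instantiated at δ itself, with the components as primitive idempotents.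
  conclude (hyp δ δ-ordering component component-isPrimitiveIdempotent)
  where
  D : Eigendecomposition A P Q δ
  D = eigendecomposition A P Q δ PQ QP QAP
  open Spectral D
  open Simple (dimension-1⇒injective dim)
  conclude : ∃[ c ] c # 0ℝ × LagrangeWeights (λ i → component i s t) δ c → Distance A s t d
  conclude (c , c#0 , weights) = topMoment⇒distance A A≥0 c#0
    (topMoment-δ⇒^ᴹ (weights⇒moments (λ i → component i s t) δ c#0 weights))

theorem1p4 : (d : ℕ) (A : Mat (suc d)) → Nonnegative A → (s t : Fin (suc d)) →
    (Diagonalizable A × Distance A s t d)
    ⇔
    (MultiplicityFree A ×
    ((θ : Fin (suc d) → ℝ) → IsEigenvalueOrdering A θ →
    (E : Fin (suc d) → Mat (suc d)) → (∀ i → IsPrimitiveIdempotent A θ i (E i)) →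
    ∃[ c ] c # 0ℝ × (∀ i → E i s t * differenceProduct θ i ≃ c)))
theorem1p4 d A A≥0 s t = mk⇔
  (λ (A-diag , dist) → distance⇒idempotents d A A≥0 s t A-diag dist)
  (λ (A-mf , hyp) → proj₁ A-mf , idempotents⇒distance d A A≥0 s t A-mf hyp)
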